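{- Let $k\geq 2$ and let $p$ be a prime. Every cyclic $(p,k,1)$-design is generated by a $(p,k,1)$-DDF.
   Context: A $(v,k,\lambda)$-design is a pair $(V,\mathcal{B})$ where $V$ is a set of $v$ points and $\mathcal{B}$ is a collection of $k$-subsets of $V$ called blocks, such that every pair of distinct elements of $V$ is contained in precisely $\lambda$ blocks of $\mathcal{B}$. An automorphism of $(V,\mathcal{B})$ is a permutation of $V$ leaving $\mathcal{B}$ invariant. The design is cyclic if it admits an automorphism consisting of a cycle of length $v$; without loss of generality $V$ is identified with $\mathbb{Z}_v$, the additive group of integers modulo $v$, so that $\mathcal{B}$ is invariant under all translations $B\mapsto B+t$, $t\in\mathbb{Z}_v$. A $(v,k,\lambda)$-cyclic difference family, or $(v,k,\lambda)$-CDF, is a family $\mathcal{F}$ of $k$-subsets (called base blocks) of $\mathbb{Z}_v$ such that the multiset $\{x-y : x,y\in F,\ x\neq y,\ F\in\mathcal{F}\}$ contains every element of $\mathbb{Z}_v\setminus\{0\}$ exactly $\lambda$ times. A $(v,k,\lambda)$-DDF (disjoint difference family) is a $(v,k,\lambda)$-CDF whose base blocks are mutually disjoint. A family $\mathcal{F}$ generates the cyclic $(v,k,\lambda)$-design whose block-multiset is $\{F+t : F\in\mathcal{F},\ t\in\mathbb{Z}_v\}$.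
   Formalization: The case k = p is excluded: there the single block Z_p is a cyclic (p,p,1)-design, but no (p,p,1)-DDF exists, since Z_p yields every nonzero difference p times; so the claim fails as literally stated for k = p. -}

module Defs where

open import Data.Fin using (Fin; toℕ; _≟_)
open import Data.Fin.Subset using (Subset; ∣_∣; _∈_; _∩_; Empty)
open import Data.Fin.Subset.Properties using (_∈?_)
open import Data.List using (List; length; map; concatMap; filter; allFin; cartesianProduct)
open import Data.List.Relation.Binary.Permutation.Propositional using (_↭_)
open import Data.List.Relation.Unary.All using (All)
open import Data.List.Relation.Unary.AllPairs using (AllPairs)
open import Data.Nat using (ℕ; NonZero; _+_; _∸_)
open import Data.Nat.DivMod using (_mod_)
open import Data.Product using (_×_; _,_; uncurry)
open import Data.Vec using (tabulate; lookup)
open import Relation.Binary.PropositionalEquality using (_≡_; _≢_)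
open import Relation.Nullary.Decidable using (_×-dec_; ¬?)

-- Fin v carries the group structure of ℤ/v; finite multisets (collections of
-- blocks, families of base blocks, lists of differences) are lists, taken up
-- to permutation _↭_.

module _ {v : ℕ} .{{_ : NonZero v}} where

  infixl 6 _⊕_ _⊖_

  _⊕_ : Fin v → Fin v → Fin v
  x ⊕ y = (toℕ x + toℕ y) mod v

  _⊖_ : Fin v → Fin v → Fin v
  x ⊖ y = (toℕ x + (v ∸ toℕ y)) mod v

  -- B + t = { b ⊕ t : b ∈ B }, through  x ∈ B + t ⇔ x ⊖ t ∈ B.
  translate : Fin v → Subset v → Subset v
  translate t B = tabulate λ x → lookup B (x ⊖ t)

elements : ∀ {v} → Subset v → List (Fin v)
elements F = filter (_∈? F) (allFin _)

multiplicity : ∀ {v} → Fin v → List (Fin v) → ℕ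
multiplicity d xs = length (filter (d ≟_) xs)

blocksThrough : ∀ {v} → Fin v → Fin v → List (Subset v) → List (Subset v)
blocksThrough x y = filter λ B → (x ∈? B) ×-dec (y ∈? B)

record IsDesign (v k l : ℕ) (𝓑 : List (Subset v)) : Set where
  field
    blockSize : All (λ B → ∣ B ∣ ≡ k) 𝓑
    balanced  : ∀ x y → x ≢ y → length (blocksThrough x y 𝓑) ≡ l

record IsCyclicDesign (v k l : ℕ) .{{_ : NonZero v}} (𝓑 : List (Subset v)) : Set where
  field
    isDesign             : IsDesign v k l 𝓑
    translationInvariant : ∀ t → map (translate t) 𝓑 ↭ 𝓑

module _ {v : ℕ} .{{_ : NonZero v}} where

  differences : Subset v → List (Fin v)
  differences F =
    map (uncurry _⊖_)
      (filter (λ (x , y) → ¬? (x ≟ y)) (cartesianProduct (elements F) (elements F)))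

  development : List (Subset v) → List (Subset v)
  development = concatMap λ F → map (λ t → translate t F) (allFin v)

  _Generates_ : List (Subset v) → List (Subset v) → Set
  𝓕 Generates 𝓑 = development 𝓕 ↭ 𝓑

record IsCDF (v k l : ℕ) .{{_ : NonZero v}} (𝓕 : List (Subset v)) : Set where
  field
    blockSize : All (λ F → ∣ F ∣ ≡ k) 𝓕
    covers    : ∀ d → toℕ d ≢ 0 → multiplicity d (concatMap differences 𝓕) ≡ l

record IsDDF (v k l : ℕ) .{{_ : NonZero v}} (𝓕 : List (Subset v)) : Set where
  field
    isCDF    : IsCDF v k l 𝓕
    disjoint : AllPairs (λ F G → Empty (F ∩ G)) 𝓕

{-# OPTIONS --safe #-}

-- Since p is prime and k ≢ p, every block has p distinct translates, so 𝓑 splits into full orbits with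
-- base blocks F₁, …, Fₙ, and c n ≤ p - 1 for c = k (k - 1) because the differences of the Fᵢ are distinct
-- and nonzero. The translates Fᵢ + tᵢ are disjoint as soon as no factor of P(t) = ∏ (tⱼ - tᵢ + d) is 0 mod p,
-- where i < j and d runs through 2c ≥ k² offsets that include all y - x with x ∈ Fᵢ, y ∈ Fⱼ.
-- Combinatorial Nullstellensatz: with m = c (n - 1), the operator Δ₁ᵐ ⋯ Δₙᵐ of iterated differences at 0
-- depends only on the leading form of P, of degree n m, hence not on the offsets. For the offsets
-- c - q with q < 2c, the product on the grid [0, m]ⁿ is nonzero mod p only at (0, c, 2c, …), so its image is a
-- nonzero multiple of ∏ᵢ binom(m, c i), and m < p. Hence the image of P is nonzero and P(t) ≢ 0 for some t.
module Submission where

open import Defs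
open import Data.Bool using (Bool; true; false)
open import Data.Fin using (Fin; zero; suc; toℕ; fromℕ<)
import Data.Fin as Fin
import Data.Fin.Properties as Fin
open import Data.Fin.Subset using (Subset; ∣_∣; _∈_; _∩_; Empty)
open import Data.Fin.Subset.Properties using (_∈?_; drop-there; x∈p∩q⁻; ∣⊤∣≡n; ∣⊥∣≡0)
open import Data.Integer using (ℤ; +_; 0ℤ; 1ℤ; -1ℤ)
import Data.Integer as ℤ
import Data.Integer.Divisibility.Signed as ℤ
import Data.Integer.Properties as ℤ
open import Data.Integer.Tactic.RingSolver using (solve-∀)
open import Data.List using (List; []; _∷_; length; map; filter; _++_; allFin; cartesianProduct; concatMap)
import Data.List as List
open import Data.List.Membership.Propositional using (lose) renaming (_∈_ to _∈ˡ_)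
open import Data.List.Membership.Propositional.Properties
  using (∈-∃++; ∈-++⁺ˡ; ∈-++⁺ʳ; ∈-++⁻; ∈-map⁺; ∈-map⁻; ∈-allFin; ∈-filter⁺; ∈-filter⁻; ∈-lookup;
         ∈-cartesianProduct⁺; ∈-cartesianProduct⁻)
open import Data.List.Membership.Propositional.Properties.WithK using (unique∧set⇒bag)
open import Data.List.Properties
  using (length-map; length-++; length-filter; length-tabulate; map-∘; map-cong; map-++; map-tabulate;
         tabulate-lookup; filter-++; filter-≐; filter-accept; filter-none; filter-some)
open import Data.List.Relation.Binary.BagAndSetEquality using (∼bag⇒↭)
open import Data.List.Relation.Binary.Permutation.Propositional
  using (_↭_; ↭-refl; ↭-sym; ↭-trans; ↭-prep; ↭-reflexive; module PermutationReasoning)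
open import Data.List.Relation.Binary.Permutation.Propositional.Properties
  using (shift; drop-∷; ∈-resp-↭; All-resp-↭; ↭-length; filter-↭; ++⁺ˡ; ++⁺ʳ)
  renaming (map⁺ to ↭-map⁺; ++⁺ to ↭-++⁺)
open import Data.List.Relation.Unary.All using (All; []; _∷_)
import Data.List.Relation.Unary.All as All
import Data.List.Relation.Unary.All.Properties as All
open import Data.List.Relation.Unary.AllPairs using (AllPairs; []; _∷_)
import Data.List.Relation.Unary.AllPairs.Properties as AllPairs
open import Data.List.Relation.Unary.Any using (here; there)
open import Data.List.Relation.Unary.Unique.Propositional using (Unique)
import Data.List.Relation.Unary.Unique.Propositional.Properties as Unique
open import Data.Nat
  using (ℕ; zero; suc; pred; _+_; _*_; _∸_; _≤_; _<_; _<?_; z≤n; s≤s; _!; NonZero; ≢-nonZero; >-nonZero; >-nonZero⁻¹;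
         nonTrivial⇒≢1)
open import Data.Nat.Combinatorics using (_C_; k![n∸k]!∣n!; nCk≡n!/k![n-k]!; nCk+nC[k+1]≡[n+1]C[k+1]; k>n⇒nCk≡0)
open import Data.Nat.Coprimality using (prime⇒coprime; coprime-Bézout)
import Data.Nat.Divisibility as ℕ
open import Data.Nat.DivMod
  using (_%_; _/_; _mod_; m/n*n≡m; %-distribˡ-+; m%n%n≡m%n; [m+n]%n≡m%n; m%n<n; m<n⇒m%n≡m; m≡m%n+[m/n]*n)
open import Data.Nat.GCD using (module Bézout)
open import Data.Nat.Primality using (Prime; euclidsLemma; prime⇒nonTrivial)
open import Data.Nat.Properties
import Data.Nat.Tactic.RingSolver as ℕSolver
open import Data.Product using (∃; _×_; _,_; proj₁; proj₂; uncurry)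
open import Data.Sum using (_⊎_; inj₁; inj₂)
open import Data.Vec using (Vec; []; _∷_; lookup; replicate; _[_]%=_; toList)
import Data.Vec as Vec
open import Data.Vec.Properties
  using (length-toList; lookup∘updateAt; lookup∘updateAt′; lookup∘tabulate; tabulate∘lookup; tabulate-cong;
         lookup-replicate; []=⇒lookup; lookup⇒[]=)
open import Function using (_∘_; mk⇔)
open import Relation.Binary.Definitions using (tri<; tri≈; tri>)
open import Relation.Binary.PropositionalEquality
  using (_≡_; _≢_; refl; sym; trans; cong; cong₂; subst; module ≡-Reasoning)
open import Relation.Nullary using (¬_; Dec; yes; no; contradiction)
open import Relation.Nullary.Decidable using (decidable-stable; _×-dec_; _⊎-dec_; ¬?)
open import Relation.Unary using (Decidable)
open import Relation.Unary.Properties using (∁?)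

-- Iterated differences and degree

diff : ℕ → (ℕ → ℤ) → ℕ → ℤ
diff zero    g = g
diff (suc m) g = diff m λ a → g (suc a) ℤ.- g a

∂ : ∀ {n} → Fin n → (Vec ℕ n → ℤ) → Vec ℕ n → ℤ
∂ i f v = f (v [ i ]%= suc) ℤ.- f v

infix 4 _hasDegree<_

-- Degree is encoded by the vanishing of all `d`-fold mixed differences, so no syntax of polynomials
-- is involved. Only the zero function has degree below 0.
_hasDegree<_ : ∀ {n} → (Vec ℕ n → ℤ) → ℕ → Set
f hasDegree< zero  = ∀ v → f v ≡ 0ℤ
f hasDegree< suc d = ∀ i → ∂ i f hasDegree< d

IsAffine : ∀ {n} → (Vec ℕ n → ℤ) → Set
IsAffine ℓ = ∀ i → ∃ λ e → ∀ v → ℓ (v [ i ]%= suc) ≡ ℓ v ℤ.+ e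

degree-cong : ∀ {n} d {f g : Vec ℕ n → ℤ} → (∀ v → f v ≡ g v) → f hasDegree< d → g hasDegree< d
degree-cong zero    f≗g f<d v = trans (sym (f≗g v)) (f<d v)
degree-cong (suc d) f≗g f<d i = degree-cong d (λ v → cong₂ ℤ._-_ (f≗g (v [ i ]%= suc)) (f≗g v)) (f<d i)

degree-suc : ∀ {n} d {f : Vec ℕ n → ℤ} → f hasDegree< d → f hasDegree< suc d
degree-suc zero    f≡0 i v = cong₂ ℤ._-_ (f≡0 (v [ i ]%= suc)) (f≡0 v)
degree-suc (suc d) f<d i   = degree-suc d (f<d i)

degree-+ : ∀ {n} d {f g : Vec ℕ n → ℤ} → f hasDegree< d → g hasDegree< d →
           (λ v → f v ℤ.+ g v) hasDegree< d
degree-+ zero    f≡0 g≡0 v = cong₂ ℤ._+_ (f≡0 v) (g≡0 v)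
degree-+ (suc d) {f} {g} f<d g<d i =
  degree-cong d (λ v → regroup (f (v [ i ]%= suc)) (f v) (g (v [ i ]%= suc)) (g v)) (degree-+ d (f<d i) (g<d i))
  where
  regroup : ∀ a b c d → (a ℤ.- b) ℤ.+ (c ℤ.- d) ≡ (a ℤ.+ c) ℤ.- (b ℤ.+ d)
  regroup = solve-∀

degree-scale : ∀ {n} d e {f : Vec ℕ n → ℤ} → f hasDegree< d → (λ v → e ℤ.* f v) hasDegree< d
degree-scale zero    e f≡0 v = trans (cong (e ℤ.*_) (f≡0 v)) (ℤ.*-zeroʳ e)
degree-scale (suc d) e {f} f<d i =
  degree-cong d (λ v → factor e (f (v [ i ]%= suc)) (f v)) (degree-scale d e (f<d i))
  where
  factor : ∀ e a b → e ℤ.* (a ℤ.- b) ≡ e ℤ.* a ℤ.- e ℤ.* b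
  factor = solve-∀

-- Leibniz rule: if `ℓ` grows by the constant `e` along `i`, then the difference of `ℓ f` is
-- `ℓ ∂f + e (f + ∂f)`, where the first term is handled by induction and the second is a multiple of
-- functions of known degree.
degree-affine-* : ∀ {n} d {ℓ f : Vec ℕ n → ℤ} → IsAffine ℓ → f hasDegree< d →
                  (λ v → ℓ v ℤ.* f v) hasDegree< suc d
degree-affine-* zero {ℓ} aff f≡0 i v
  rewrite f≡0 (v [ i ]%= suc) | f≡0 v = cong₂ ℤ._-_ (ℤ.*-zeroʳ (ℓ (v [ i ]%= suc))) (ℤ.*-zeroʳ (ℓ v))
degree-affine-* (suc d) {ℓ} {f} aff f<d i with aff i
... | e , ℓ-step = degree-cong (suc d) leibniz
  (degree-+ (suc d) {λ v → ℓ v ℤ.* ∂ i f v} (degree-affine-* d {ℓ} aff (f<d i))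
    (degree-scale (suc d) e {λ v → f v ℤ.+ ∂ i f v}
      (degree-+ (suc d) {f} f<d (degree-suc d {∂ i f} (f<d i)))))
  where
  expand : ∀ l e a b → l ℤ.* (a ℤ.- b) ℤ.+ e ℤ.* (b ℤ.+ (a ℤ.- b)) ≡ (l ℤ.+ e) ℤ.* a ℤ.- l ℤ.* b
  expand = solve-∀
  leibniz : ∀ v → ℓ v ℤ.* ∂ i f v ℤ.+ e ℤ.* (f v ℤ.+ ∂ i f v) ≡ ∂ i (λ w → ℓ w ℤ.* f w) v
  leibniz v = trans (expand (ℓ v) e (f (v [ i ]%= suc)) (f v))
    (cong (λ l → l ℤ.* f (v [ i ]%= suc) ℤ.- ℓ v ℤ.* f v) (sym (ℓ-step v)))

degree-restrict : ∀ {n} d x {f : Vec ℕ (suc n) → ℤ} → f hasDegree< d → (λ v → f (x ∷ v)) hasDegree< d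
degree-restrict zero    x f≡0 v = f≡0 (x ∷ v)
degree-restrict (suc d) x f<d i = degree-restrict d x (f<d (suc i))

-- Each difference in the first variable lowers the total degree by one; what is left bounds the
-- degree in the other variables.
degree-diff : ∀ {n} m d x {f : Vec ℕ (suc n) → ℤ} → f hasDegree< m + d →
              (λ v → diff m (λ a → f (a ∷ v)) x) hasDegree< d
degree-diff zero    d x f<d = degree-restrict d x f<d
degree-diff (suc m) d x f<d = degree-diff m d x (f<d zero)

-- On polynomials of degree at most n m this is (m!)ⁿ times the coefficient of ∏ xᵢᵐ.
top : ∀ n → ℕ → (Vec ℕ n → ℤ) → ℤ
top zero    m f = f []
top (suc n) m f = top n m λ v → diff m (λ a → f (a ∷ v)) 0

top-vanishes : ∀ n m {f} → f hasDegree< n * m → top n m f ≡ 0ℤ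
top-vanishes zero    m f≡0 = f≡0 []
top-vanishes (suc n) m f<d = top-vanishes n m (degree-diff m (n * m) 0 f<d)

diff-cong : ∀ m {g h : ℕ → ℤ} x → (∀ a → g a ≡ h a) → diff m g x ≡ diff m h x
diff-cong zero    x g≗h = g≗h x
diff-cong (suc m) x g≗h = diff-cong m x λ a → cong₂ ℤ._-_ (g≗h (suc a)) (g≗h a)

diff-- : ∀ m (g h : ℕ → ℤ) x → diff m (λ a → g a ℤ.- h a) x ≡ diff m g x ℤ.- diff m h x
diff-- zero    g h x = refl
diff-- (suc m) g h x = trans (diff-cong m x λ a → regroup (g (suc a)) (h (suc a)) (g a) (h a)) (diff-- m _ _ x)
  where
  regroup : ∀ a b c d → (a ℤ.- b) ℤ.- (c ℤ.- d) ≡ (a ℤ.- c) ℤ.- (b ℤ.- d)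
  regroup = solve-∀

diff-scale : ∀ m e (g : ℕ → ℤ) x → diff m (λ a → e ℤ.* g a) x ≡ e ℤ.* diff m g x
diff-scale zero    e g x = refl
diff-scale (suc m) e g x = trans (diff-cong m x λ a → factor e (g (suc a)) (g a)) (diff-scale m e _ x)
  where
  factor : ∀ e a b → e ℤ.* a ℤ.- e ℤ.* b ≡ e ℤ.* (a ℤ.- b)
  factor = solve-∀

top-- : ∀ n m (f g : Vec ℕ n → ℤ) → top n m (λ v → f v ℤ.- g v) ≡ top n m f ℤ.- top n m g
top-cong : ∀ n m {f g : Vec ℕ n → ℤ} → (∀ v → f v ≡ g v) → top n m f ≡ top n m g
top-cong zero    m f≗g = f≗g []
top-cong (suc n) m f≗g = top-cong n m λ v → diff-cong m 0 λ a → f≗g (a ∷ v)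
top-- zero    m f g = refl
top-- (suc n) m f g = trans (top-cong n m λ v → diff-- m (λ a → f (a ∷ v)) (λ a → g (a ∷ v)) 0) (top-- n m _ _)

-- By linearity it suffices that `top` kills `f - g`. So `top` sees only the terms of degree
-- `n * m`, which permits an exchange of offsets.
top-determined : ∀ n m {f g : Vec ℕ n → ℤ} → (λ v → f v ℤ.- g v) hasDegree< n * m → top n m f ≡ top n m g
top-determined n m {f} {g} f-g<d = ℤ.i-j≡0⇒i≡j _ _ (trans (sym (top-- n m f g)) (top-vanishes n m f-g<d))

-- Iterated differences modulo a prime

module _ (p : ℕ) where

  -- If `p` divided both `g (suc a)` and `g a`, it would divide their difference; so nondivisibility
  -- passes back to one of the two values.
  diff-∤ : ∀ m {g : ℕ → ℤ} x → ¬ + p ℤ.∣ diff m g x → ∃ λ a → ¬ + p ℤ.∣ g a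
  diff-∤ zero    x p∤ = x , p∤
  diff-∤ (suc m) {g} x p∤ with diff-∤ m x p∤
  ... | a , p∤Δ with + p ℤ.∣? g a
  ...   | no p∤ga  = a , p∤ga
  ...   | yes p∣ga = suc a , λ p∣gsa → p∤Δ (ℤ.∣m∣n⇒∣m-n p∣gsa p∣ga)

  top-∤ : ∀ n m {f : Vec ℕ n → ℤ} → ¬ + p ℤ.∣ top n m f → ∃ λ v → ¬ + p ℤ.∣ f v
  top-∤ zero    m p∤ = [] , p∤
  top-∤ (suc n) m p∤ with top-∤ n m p∤
  ... | v , p∤Δ with diff-∤ m 0 p∤Δ
  ...   | a , p∤f = a ∷ v , p∤f

  diff-∣ : ∀ m {g : ℕ → ℤ} x → (∀ a → a ≤ m + x → + p ℤ.∣ g a) → + p ℤ.∣ diff m g x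
  diff-∣ zero    x p∣ = p∣ x ≤-refl
  diff-∣ (suc m) x p∣ = diff-∣ m x λ a a≤ → ℤ.∣m∣n⇒∣m-n (p∣ (suc a) (s≤s a≤)) (p∣ a (m≤n⇒m≤1+n a≤))

-- Kronecker delta, by recursion on both arguments, so that it is definitionally unchanged when both
-- grow by one; the induction in `diff-δ` relies on this.
δ : ℕ → ℕ → ℤ
δ zero    zero    = 1ℤ
δ zero    (suc b) = 0ℤ
δ (suc a) zero    = 0ℤ
δ (suc a) (suc b) = δ a b

δ-refl : ∀ a → δ a a ≡ 1ℤ
δ-refl zero    = refl
δ-refl (suc a) = δ-refl a

δ-≢ : ∀ {a b} → a ≢ b → δ a b ≡ 0ℤ
δ-≢ {zero}  {zero}  a≢b = contradiction refl a≢b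
δ-≢ {zero}  {suc b} a≢b = refl
δ-≢ {suc a} {zero}  a≢b = refl
δ-≢ {suc a} {suc b} a≢b = δ-≢ (a≢b ∘ cong suc)

-- This is the coefficient of `g a` in the `m`-th difference of `g` at 0; the sign `(-1)^(m - a)` is
-- written without subtraction. The induction is Pascal's rule.
diff-δ : ∀ m a → diff m (δ a) 0 ≡ -1ℤ ℤ.^ (m + a) ℤ.* + (m C a)
diff-δ zero    zero    = refl
diff-δ zero    (suc a) = sym (trans
  (cong (λ c → -1ℤ ℤ.^ suc a ℤ.* + c) (k>n⇒nCk≡0 {0} {suc a} (s≤s z≤n))) (ℤ.*-zeroʳ (-1ℤ ℤ.^ suc a)))
diff-δ (suc m) zero    = trans (diff-cong m 0 step)
  (trans (diff-scale m -1ℤ (δ 0) 0) (trans (cong (-1ℤ ℤ.*_) (diff-δ m zero)) rest))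
  where
  step : ∀ a → δ 0 (suc a) ℤ.- δ 0 a ≡ -1ℤ ℤ.* δ 0 a
  step zero = refl
  step (suc a) = refl
  rest : -1ℤ ℤ.* (-1ℤ ℤ.^ (m + 0) ℤ.* + (m C 0)) ≡ -1ℤ ℤ.^ (suc m + 0) ℤ.* + (suc m C 0)
  rest = sym (ℤ.*-assoc -1ℤ (-1ℤ ℤ.^ (m + 0)) 1ℤ)
diff-δ (suc m) (suc a) = trans (diff-- m (δ a) (δ (suc a)) 0)
  (trans (cong₂ ℤ._-_ (diff-δ m a) (diff-δ m (suc a))) rest)
  where
  pascal : ∀ s x y → s ℤ.* x ℤ.- (-1ℤ ℤ.* s) ℤ.* y ≡ (-1ℤ ℤ.* (-1ℤ ℤ.* s)) ℤ.* (x ℤ.+ y)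
  pascal = solve-∀
  rest : -1ℤ ℤ.^ (m + a) ℤ.* + (m C a) ℤ.- -1ℤ ℤ.^ (m + suc a) ℤ.* + (m C suc a)
       ≡ -1ℤ ℤ.^ (suc m + suc a) ℤ.* + (suc m C suc a)
  rest rewrite +-suc m a | sym (nCk+nC[k+1]≡[n+1]C[k+1] m a) = pascal (-1ℤ ℤ.^ (m + a)) (+ (m C a)) (+ (m C suc a))

module _ {p : ℕ} (pp : Prime p) where

  p∤1 : ¬ p ℕ.∣ 1
  p∤1 p∣1 with ℕ.∣1⇒≡1 p∣1
  ... | refl = contradiction refl (nonTrivial⇒≢1 ⦃ prime⇒nonTrivial pp ⦄)

  p∤n! : ∀ n → n < p → ¬ p ℕ.∣ n !
  p∤n! zero    _   = p∤1
  p∤n! (suc n) n<p p∣ with euclidsLemma (suc n) (n !) pp p∣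
  ... | inj₁ p∣n  = contradiction (ℕ.∣⇒≤ p∣n) (<⇒≱ n<p)
  ... | inj₂ p∣n! = p∤n! n (<-trans (n<1+n n) n<p) p∣n!

  p∤nCk : ∀ {n k} → k ≤ n → n < p → ¬ p ℕ.∣ n C k
  p∤nCk {n} {k} k≤n n<p p∣C = p∤n! n n<p (subst (p ℕ.∣_) C*k!≡n! (ℕ.∣m⇒∣m*n (k ! * (n ∸ k) !) p∣C))
    where
    instance _ = k !* (n ∸ k) !≢0
    C*k!≡n! : (n C k) * (k ! * (n ∸ k) !) ≡ n !
    C*k!≡n! = trans (cong (_* (k ! * (n ∸ k) !)) (nCk≡n!/k![n-k]! k≤n)) (m/n*n≡m (k![n∸k]!∣n! k≤n))

  ∤-* : ∀ {x y} → ¬ + p ℤ.∣ x → ¬ + p ℤ.∣ y → ¬ + p ℤ.∣ x ℤ.* y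
  ∤-* {x} {y} p∤x p∤y p∣xy with euclidsLemma (ℤ.∣_∣ x) (ℤ.∣_∣ y) pp (subst (p ℕ.∣_) (ℤ.abs-* x y) (ℤ.∣⇒∣ᵤ p∣xy))
  ... | inj₁ p∣x = p∤x (ℤ.∣ᵤ⇒∣ p∣x)
  ... | inj₂ p∣y = p∤y (ℤ.∣ᵤ⇒∣ p∣y)

  ∤-±1 : ∀ n → ¬ + p ℤ.∣ -1ℤ ℤ.^ n
  ∤-±1 zero    p∣ = p∤1 (ℤ.∣⇒∣ᵤ p∣)
  ∤-±1 (suc n) = ∤-* (p∤1 ∘ ℤ.∣⇒∣ᵤ) (∤-±1 n)

  -- Subtracting the spike `g a * δ a` leaves a function divisible by `p` on `[0, m]`, so its `m`-th
  -- difference is divisible too. The spike contributes `g a` times a signed binomial coefficient,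
  -- nonzero mod `p` because `m < p`.
  diff-isolated : ∀ {m} {g : ℕ → ℤ} {a} → m < p → a ≤ m → ¬ + p ℤ.∣ g a →
                  (∀ b → b ≤ m → b ≢ a → + p ℤ.∣ g b) → ¬ + p ℤ.∣ diff m g 0
  diff-isolated {m} {g} {a} m<p a≤m p∤ga p∣gb p∣diff =
    ∤-* p∤ga p∤δ (ℤ.∣m+n∣m⇒∣n (subst (+ p ℤ.∣_) (sym cancel) p∣diff) p∣rest)
    where
    h : ℕ → ℤ
    h b = g b ℤ.- g a ℤ.* δ a b
    p∣h : ∀ b → b ≤ m + 0 → + p ℤ.∣ h b
    p∣h b b≤ with b ≟ a
    ... | yes refl rewrite δ-refl a | ℤ.*-identityʳ (g a) | ℤ.+-inverseʳ (g a) = ℤ.∣ᵤ⇒∣ (p ℕ.∣0)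
    ... | no  b≢a  rewrite δ-≢ {a} {b} (b≢a ∘ sym) | ℤ.*-zeroʳ (g a) | ℤ.+-identityʳ (g b) =
      p∣gb b (subst (b ≤_) (+-identityʳ m) b≤) b≢a
    p∣rest : + p ℤ.∣ diff m h 0
    p∣rest = diff-∣ p m 0 p∣h
    collapse : ∀ x y → (x ℤ.- y) ℤ.+ y ≡ x
    collapse = solve-∀
    cancel : diff m h 0 ℤ.+ g a ℤ.* diff m (δ a) 0 ≡ diff m g 0
    cancel = trans (cong₂ ℤ._+_ (diff-- m g _ 0) (sym (diff-scale m (g a) (δ a) 0))) (collapse (diff m g 0) _)
    p∤δ : ¬ + p ℤ.∣ diff m (δ a) 0
    p∤δ = subst (λ z → ¬ + p ℤ.∣ z) (sym (diff-δ m a)) (∤-* (∤-±1 (m + a)) (p∤nCk a≤m m<p ∘ ℤ.∣⇒∣ᵤ))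

module _ {p : ℕ} (pp : Prime p) where

  -- Induction on the variables: differencing in the first one gives a function that is nonzero mod
  -- `p` on the grid only at the tail of `w`. At that tail `diff-isolated` applies; at any other
  -- tail all values entering the difference are divisible.
  top-isolated : ∀ n {m} {f : Vec ℕ n → ℤ} {w} → m < p → (∀ i → lookup w i ≤ m) → ¬ + p ℤ.∣ f w →
                 (∀ v → (∀ i → lookup v i ≤ m) → v ≢ w → + p ℤ.∣ f v) → ¬ + p ℤ.∣ top n m f
  top-isolated zero    {w = []}    m<p w≤m p∤fw p∣f = p∤fw
  top-isolated (suc n) {m} {f} {a ∷ w} m<p w≤m p∤fw p∣f = top-isolated n m<p (w≤m ∘ suc)
    (diff-isolated pp m<p (w≤m zero) p∤fw
      λ b b≤m b≢a → p∣f (b ∷ w) (λ { zero → b≤m ; (suc i) → w≤m (suc i) }) λ { refl → b≢a refl })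
    λ v v≤m v≢w → diff-∣ p m 0
      λ b b≤m → p∣f (b ∷ v) (λ { zero → subst (b ≤_) (+-identityʳ m) b≤m ; (suc i) → v≤m i }) λ { refl → v≢w refl }

-- Products of gaps

module _ {n : ℕ} {B : Set} where

  Index : Set
  Index = (Fin n × Fin n) × B

  gap : (Index → ℤ) → Index → Vec ℕ n → ℤ
  gap o e@((i , j) , _) v = + lookup v j ℤ.- + lookup v i ℤ.+ o e

  gapProduct : (Index → ℤ) → List Index → Vec ℕ n → ℤ
  gapProduct o []       v = 1ℤ
  gapProduct o (e ∷ es) v = gap o e v ℤ.* gapProduct o es v

  lookup-affine : ∀ (j : Fin n) → IsAffine (λ v → + lookup v j)
  lookup-affine j i with i Fin.≟ j
  ... | yes refl = 1ℤ , λ v → trans (cong +_ (lookup∘updateAt i v)) (ℤ.+-comm 1ℤ (+ lookup v i))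
  ... | no  i≢j  = 0ℤ , λ v → trans (cong +_ (lookup∘updateAt′ j i (i≢j ∘ sym) v)) (sym (ℤ.+-identityʳ _))

  gap-affine : ∀ o e → IsAffine (gap o e)
  gap-affine o e@((i , j) , _) s with lookup-affine j s | lookup-affine i s
  ... | dj , stepj | di , stepi = dj ℤ.- di , λ v →
    trans (cong₂ (λ x y → x ℤ.- y ℤ.+ o e) (stepj v) (stepi v)) (regroup (+ lookup v j) dj (+ lookup v i) di (o e))
    where
    regroup : ∀ a x b y c → (a ℤ.+ x) ℤ.- (b ℤ.+ y) ℤ.+ c ≡ (a ℤ.- b ℤ.+ c) ℤ.+ (x ℤ.- y)
    regroup = solve-∀

  gapProduct-degree : ∀ o es → gapProduct o es hasDegree< suc (length es)
  gapProduct-degree o []       i v = refl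
  gapProduct-degree o (e ∷ es) =
    degree-affine-* (suc (length es)) {gap o e} {gapProduct o es} (gap-affine o e) (gapProduct-degree o es)

  -- Offsets do not affect the linear part of a factor, so the leading forms of the two products
  -- cancel. The proof telescopes one factor at a time: `(y + x) a - (y + x′) b = (y + x) (a - b) +
  -- (x - x′) b`.
  gapProduct-offsets : ∀ o o′ es →
    (λ v → gapProduct o es v ℤ.- gapProduct o′ es v) hasDegree< length es
  gapProduct-offsets o o′ []       v = refl
  gapProduct-offsets o o′ (e@((i , j) , _) ∷ es) = degree-cong (suc d) telescope
    (degree-+ (suc d) {λ v → gap o e v ℤ.* (P v ℤ.- Q v)}
      (degree-affine-* d {gap o e} {λ v → P v ℤ.- Q v} (gap-affine o e) (gapProduct-offsets o o′ es))
      (degree-scale (suc d) (o e ℤ.- o′ e) {Q} (gapProduct-degree o′ es)))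
    where
    d = length es
    P = gapProduct o es
    Q = gapProduct o′ es
    identity : ∀ x x′ y a b → (y ℤ.+ x) ℤ.* (a ℤ.- b) ℤ.+ (x ℤ.- x′) ℤ.* b ≡ (y ℤ.+ x) ℤ.* a ℤ.- (y ℤ.+ x′) ℤ.* b
    identity = solve-∀
    telescope : ∀ v → gap o e v ℤ.* (P v ℤ.- Q v) ℤ.+ (o e ℤ.- o′ e) ℤ.* Q v
                    ≡ gapProduct o (e ∷ es) v ℤ.- gapProduct o′ (e ∷ es) v
    telescope v = identity (o e) (o′ e) (+ lookup v j ℤ.- + lookup v i) (P v) (Q v)

  gapProduct-∣ : ∀ {q o es e v} → e ∈ˡ es → q ℤ.∣ gap o e v → q ℤ.∣ gapProduct o es v
  gapProduct-∣ {o = o} {_ ∷ es} {v = v} (here refl) q∣ = ℤ.∣m⇒∣m*n (gapProduct o es v) q∣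
  gapProduct-∣ {o = o} {e ∷ es} {v = v} (there e∈)  q∣ = ℤ.∣n⇒∣m*n (gap o e v) (gapProduct-∣ e∈ q∣)

  gapProduct-∤ : ∀ {p o es v} → Prime p → (∀ {e} → e ∈ˡ es → ¬ + p ℤ.∣ gap o e v) → ¬ + p ℤ.∣ gapProduct o es v
  gapProduct-∤ {es = []}     pp p∤ = ∤-±1 pp 0
  gapProduct-∤ {es = e ∷ es} pp p∤ = ∤-* pp (p∤ (here refl)) (gapProduct-∤ {es = es} pp (p∤ ∘ there))

orderedPairs : ∀ n → List (Fin n × Fin n)
orderedPairs zero    = []
orderedPairs (suc n) = map (λ j → zero , suc j) (allFin n) ++ map (λ (i , j) → suc i , suc j) (orderedPairs n)

∈-orderedPairs⁺ : ∀ {n} {i j : Fin n} → i Fin.< j → (i , j) ∈ˡ orderedPairs n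
∈-orderedPairs⁺ {i = zero}  {suc j} _         = ∈-++⁺ˡ (∈-map⁺ _ (∈-allFin j))
∈-orderedPairs⁺ {i = suc i} {suc j} (s≤s i<j) = ∈-++⁺ʳ _ (∈-map⁺ _ (∈-orderedPairs⁺ i<j))

∈-orderedPairs⁻ : ∀ n {i j : Fin n} → (i , j) ∈ˡ orderedPairs n → i Fin.< j
∈-orderedPairs⁻ (suc n) ij∈ with ∈-++⁻ (map (λ j → zero , suc j) (allFin n)) ij∈
... | inj₁ ∈0 with ∈-map⁻ _ ∈0
...   | j , _ , refl = s≤s z≤n
∈-orderedPairs⁻ (suc n) ij∈ | inj₂ ∈s with ∈-map⁻ _ ∈s
...   | _ , ij∈′ , refl = s≤s (∈-orderedPairs⁻ n ij∈′)

-- Doubled to avoid a division. With `2c` labels per pair the number of factors becomes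
-- `n * (c * pred n)`, the degree that `top` detects for `m = c (n - 1)`.
length-orderedPairs : ∀ n → length (orderedPairs n) * 2 ≡ n * pred n
length-orderedPairs zero    = refl
length-orderedPairs (suc n) = trans (cong (_* 2) lengths) (trans (*-distribʳ-+ 2 n _)
  (trans (cong (λ l → n * 2 + l) (length-orderedPairs n)) (arith n)))
  where
  lengths : length (orderedPairs (suc n)) ≡ n + length (orderedPairs n)
  lengths = trans (length-++ (map _ (allFin n))) (cong₂ _+_
    (trans (length-map _ (allFin n)) (length-tabulate _)) (length-map _ (orderedPairs n)))
  arith : ∀ n → n * 2 + n * pred n ≡ suc n * n
  arith zero    = refl
  arith (suc n) = ring n
    where
    ring : ∀ n → suc n * 2 + suc n * n ≡ suc (suc n) * suc n
    ring = ℕSolver.solve-∀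

-- Packing disjoint segments

length-filter-∁ : ∀ {A : Set} {P : A → Set} (P? : Decidable P) xs →
                  length (filter P? xs) + length (filter (∁? P?) xs) ≡ length xs
length-filter-∁ P? []       = refl
length-filter-∁ P? (x ∷ xs) with P? x
... | yes _ = cong suc (length-filter-∁ P? xs)
... | no  _ = trans (+-suc _ _) (cong suc (length-filter-∁ P? xs))

module _ (c : ℕ) where

  -- The segments [a, a + c) and [b, b + c) are disjoint, and not adjacent if b comes first: this
  -- asymmetry leaves a single order for tightly packed segments.
  Separated : ℕ → ℕ → Set
  Separated a b = a + c ≤ b ⊎ b + c < a

  separated-below : ∀ {a b} → Separated a b → b < a → b + c < a
  separated-below (inj₂ b+c<a) _   = b+c<a
  separated-below (inj₁ a+c≤b) b<a = contradiction b<a (≤⇒≯ (m+n≤o⇒m≤o _ a+c≤b))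

  separated-above : ∀ {a b} → Separated a b → ¬ b < a → a + c ≤ b
  separated-above (inj₁ a+c≤b) _   = a+c≤b
  separated-above (inj₂ b+c<a) b≮a = contradiction (≤-trans (s≤s (m≤m+n _ c)) b+c<a) b≮a

  Packed : ℕ → ℕ → ℕ → Set
  Packed lo hi a = lo ≤ a × a + c ≤ hi

  -- The bounds are quantified inside because the induction splits the interval. The premise
  -- `lo ≤ hi` settles the empty list.
  Packing : List ℕ → Set
  Packing xs = ∀ lo hi → AllPairs Separated xs → All (Packed lo hi) xs → lo ≤ hi → lo + c * length xs ≤ hi

  -- Points below x end by x - 1 at the latest, so y may be taken as x or as x - 1.
  packing-straddle : ∀ {x xs lo hi} y → (∀ ys → length ys ≤ length xs → Packing ys) →
    AllPairs Separated (x ∷ xs) → All (Packed lo hi) (x ∷ xs) →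
    lo ≤ y → (∀ {b} → b < x → b ≤ y) → lo + c * suc (length xs) + x ≤ y + hi
  packing-straddle {x} {xs} {lo} {hi} y pack (x-sep ∷ sep) ((lo≤x , x+c≤hi) ∷ packed) lo≤y <x⇒≤y = begin
    lo + c * suc (length xs) + x
      ≡⟨ cong (λ l → lo + c * suc l + x) (length-filter-∁ (_<? x) xs) ⟨
    lo + c * suc (length lower + length upper) + x
      ≡⟨ ring lo c x (length lower) (length upper) ⟩
    (lo + c * length lower) + (x + c + c * length upper)
      ≤⟨ +-mono-≤ lower-packs upper-packs ⟩
    y + hi ∎
    where
    open ≤-Reasoning
    ring : ∀ lo c x a b → lo + c * suc (a + b) + x ≡ (lo + c * a) + (x + c + c * b)
    ring = ℕSolver.solve-∀
    lower = filter (_<? x) xs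
    upper = filter (∁? (_<? x)) xs
    below : All (λ b → b + c < x) lower
    below = All.zipWith (λ (s , b<x) → separated-below s b<x)
      (All.filter⁺ (_<? x) x-sep , All.all-filter (_<? x) xs)
    above : All (x + c ≤_) upper
    above = All.zipWith (λ (s , b≮x) → separated-above s b≮x)
      (All.filter⁺ (∁? (_<? x)) x-sep , All.all-filter (∁? (_<? x)) xs)
    lower-packs : lo + c * length lower ≤ y
    lower-packs = pack lower (length-filter (_<? x) xs) lo y (AllPairs.filter⁺ (_<? x) sep)
      (All.zipWith (λ ((lo≤b , _) , b+c<x) → lo≤b , <x⇒≤y b+c<x) (All.filter⁺ (_<? x) packed , below)) lo≤y
    upper-packs : x + c + c * length upper ≤ hi
    upper-packs = pack upper (length-filter (∁? (_<? x)) xs) (x + c) hi (AllPairs.filter⁺ (∁? (_<? x)) sep)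
      (All.zipWith (λ ((_ , b+c≤hi) , x+c≤b) → x+c≤b , b+c≤hi) (All.filter⁺ (∁? (_<? x)) packed , above)) x+c≤hi

  -- The first segment splits the others into those below and those above it. These are filtered
  -- lists, not structural sublists, so the induction runs on a bound `N` for the length. With
  -- `y = x` in `packing-straddle`, `x` cancels.
  packing-bounded : ∀ N xs → length xs ≤ N → Packing xs
  packing-bounded N       []       _          lo hi _   _      lo≤hi =
    subst (_≤ hi) (sym (trans (cong (λ z → lo + z) (*-zeroʳ c)) (+-identityʳ lo))) lo≤hi
  packing-bounded (suc N) (x ∷ xs) (s≤s len≤) lo hi sep packed@((lo≤x , _) ∷ _) _ =
    +-cancelʳ-≤ x _ hi (subst (lo + c * suc (length xs) + x ≤_) (+-comm x hi)
      (packing-straddle x (λ ys ys≤ → packing-bounded N ys (≤-trans ys≤ len≤)) sep packed lo≤x <⇒≤))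

  packing : ∀ xs → Packing xs
  packing xs = packing-bounded (length xs) xs ≤-refl

  progression : ∀ n → ℕ → Vec ℕ n
  progression zero    lo = []
  progression (suc n) lo = lo ∷ progression n (lo + c)

  lookup-progression : ∀ {n} lo (i : Fin n) → lookup (progression n lo) i ≡ lo + c * toℕ i
  lookup-progression lo zero    = sym (trans (cong (λ z → lo + z) (*-zeroʳ c)) (+-identityʳ lo))
  lookup-progression lo (suc i) = trans (lookup-progression (lo + c) i)
    (trans (+-assoc lo c _) (cong (λ z → lo + z) (sym (*-suc c (toℕ i)))))

  -- No slack is left, so the first entry listed must sit at `lo`. The remaining segments then lie
  -- in `[lo + c, hi)`, where induction applies.
  tight-packing : ∀ {n} (v : Vec ℕ n) {lo hi} → AllPairs Separated (toList v) → All (Packed lo hi) (toList v) →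
                  hi ≤ lo + c * n → v ≡ progression n lo
  tight-packing []      _  _ _ = refl
  tight-packing {suc n} (x ∷ v) {lo} {hi} sep@(x-sep ∷ v-sep) packed@((lo≤x , x+c≤hi) ∷ v-packed) hi≤ =
    cong₂ _∷_ x≡lo (subst (λ z → v ≡ progression n (z + c)) x≡lo
      (tight-packing v v-sep
        (All.zipWith
          (λ ((lo≤b , b+c≤hi) , s) → separated-above s (λ b<x → <⇒≱ (subst (_ <_) x≡lo b<x) lo≤b) , b+c≤hi)
          (v-packed , x-sep))
        (≤-trans hi≤ (≤-reflexive hi-tail))))
    where
    x≡lo : x ≡ lo
    x≡lo with <-cmp lo x
    ... | tri≈ _ lo≡x _ = sym lo≡x
    ... | tri> _ _ x<lo = contradiction lo≤x (<⇒≱ x<lo)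
    -- Here `x = suc y`. By the asymmetry of `Separated`, segments starting below `x` end by `y`,
    -- which wastes one unit where none is to spare.
    ... | tri< (s≤s {n = y} lo≤y) _ _ =
      contradiction hi≤ (<⇒≱ (+-cancelˡ-≤ y _ hi (subst (_≤ y + hi) shuffle
        (packing-straddle y (λ ys _ → packing ys) sep packed lo≤y λ { (s≤s b≤y) → b≤y }))))
      where
      shuffle : lo + c * suc (length (toList v)) + suc y ≡ y + suc (lo + c * suc n)
      shuffle rewrite length-toList v = ring (lo + c * suc n) y
        where
        ring : ∀ a y → a + suc y ≡ y + suc a
        ring = ℕSolver.solve-∀
    hi-tail : lo + c * suc n ≡ x + c + c * n
    hi-tail rewrite x≡lo = trans (cong (λ z → lo + z) (*-suc c n)) (sym (+-assoc lo c _))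

length-cartesianProduct : ∀ {A B : Set} (xs : List A) (ys : List B) →
                          length (cartesianProduct xs ys) ≡ length xs * length ys
length-cartesianProduct []       ys = refl
length-cartesianProduct (x ∷ xs) ys =
  trans (length-++ (map (x ,_) ys)) (cong₂ _+_ (length-map (x ,_) ys) (length-cartesianProduct xs ys))

toList-All⁺ : ∀ {n} {P : ℕ → Set} (v : Vec ℕ n) → (∀ i → P (lookup v i)) → All P (toList v)
toList-All⁺ []      p = []
toList-All⁺ (x ∷ v) p = p zero ∷ toList-All⁺ v (p ∘ suc)

toList-AllPairs⁺ : ∀ {n} {R : ℕ → ℕ → Set} (v : Vec ℕ n) →
                   (∀ {i j} → i Fin.< j → R (lookup v i) (lookup v j)) → AllPairs R (toList v)
toList-AllPairs⁺ []      r = []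
toList-AllPairs⁺ (x ∷ v) r = toList-All⁺ v (λ i → r (s≤s z≤n)) ∷ toList-AllPairs⁺ v (r ∘ s≤s)

-- With the offsets c - q, the product of the gaps vanishes mod p on the grid [0, c (n - 1)]ⁿ
-- except at (0, c, 2c, …): elsewhere the segments [tᵢ, tᵢ + c) cannot be packed into [0, c n).
module _ (c : ℕ) where

  calibrated : ∀ {n} → Index {n} {Fin (c + c)} → ℤ
  calibrated (_ , q) = + c ℤ.- + toℕ q

  calibrated-gap : ∀ a b q → + b ℤ.- + a ℤ.+ (+ c ℤ.- + q) ≡ + (b + c) ℤ.- + (q + a)
  calibrated-gap a b q = regroup (+ a) (+ b) (+ c) (+ q)
    where
    regroup : ∀ a b c q → b ℤ.- a ℤ.+ (c ℤ.- q) ≡ (b ℤ.+ c) ℤ.- (q ℤ.+ a)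
    regroup = solve-∀

  -- The label is `q = b + c - a`: failure of the second alternative of `Separated` makes it
  -- nonnegative, failure of the first makes it less than `2c`.
  non-separated : ∀ {a b} → ¬ Separated c a b → ∃ λ (q : Fin (c + c)) → toℕ q + a ≡ b + c
  non-separated {a} {b} ¬sep =
    fromℕ< q<2c , trans (cong (_+ a) (Fin.toℕ-fromℕ< q<2c)) (m∸n+n≡m a≤b+c)
    where
    a≤b+c : a ≤ b + c
    a≤b+c = ≮⇒≥ (¬sep ∘ inj₂)
    arith : ∀ a c → a + c + c ≡ c + c + a
    arith = ℕSolver.solve-∀
    q<2c : b + c ∸ a < c + c
    q<2c = +-cancelʳ-< a (b + c ∸ a) (c + c) (subst (_< c + c + a) (sym (m∸n+n≡m a≤b+c))
      (subst (b + c <_) (arith a c) (+-monoˡ-< c (≰⇒> (¬sep ∘ inj₁)))))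

  separated? : ∀ a b → Dec (Separated c a b)
  separated? a b = a + c ≤? b ⊎-dec b + c <? a

  calibrated-gap≡0 : ∀ {n} (v : Vec ℕ n) {i j} q → toℕ q + lookup v i ≡ lookup v j + c →
                     gap calibrated ((i , j) , q) v ≡ 0ℤ
  calibrated-gap≡0 v {i} {j} q eq = trans (calibrated-gap (lookup v i) (lookup v j) (toℕ q))
    (trans (cong (λ z → + (lookup v j + c) ℤ.- + z) eq) (ℤ.+-inverseʳ (+ (lookup v j + c))))

  -- The gap is `c (j - i) + c - q`. It is positive because `q < 2c` and `i < j`, and it is at most
  -- `c * n < p`.
  progression-gap-∤ : ∀ {p n} → c * n < p → {i j : Fin n} → i Fin.< j → ∀ q →
                      ¬ + p ℤ.∣ gap calibrated ((i , j) , q) (progression c n 0)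
  progression-gap-∤ {p} {n} cn<p {i} {j} i<j q p∣gap =
    <⇒≱ d<p (ℕ.∣⇒≤ ⦃ >-nonZero (m<n⇒0<n∸m x<b+c) ⦄ (ℤ.∣⇒∣ᵤ (subst (+ p ℤ.∣_) gap≡d p∣gap)))
    where
    a = c * toℕ i
    b = c * toℕ j
    x = toℕ q + a
    d = b + c ∸ x
    arith : ∀ c i → c + c + c * i ≡ c * suc i + c
    arith = ℕSolver.solve-∀
    x<b+c : x < b + c
    x<b+c = begin-strict
      toℕ q + a           <⟨ +-monoˡ-< a (Fin.toℕ<n q) ⟩
      c + c + a           ≡⟨ arith c (toℕ i) ⟩
      c * suc (toℕ i) + c ≤⟨ +-monoˡ-≤ c (*-monoʳ-≤ c i<j) ⟩
      b + c               ∎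
      where open ≤-Reasoning
    b+c≤cn : b + c ≤ c * n
    b+c≤cn = ≤-trans (≤-reflexive (trans (+-comm b c) (sym (*-suc c (toℕ j))))) (*-monoʳ-≤ c (Fin.toℕ<n j))
    d<p : d < p
    d<p = ≤-<-trans (m∸n≤m (b + c) x) (≤-<-trans b+c≤cn cn<p)
    gap≡d : gap calibrated ((i , j) , q) (progression c n 0) ≡ + d
    gap≡d = trans
      (cong₂ (λ s t → + t ℤ.- + s ℤ.+ (+ c ℤ.- + toℕ q)) (lookup-progression c 0 i) (lookup-progression c 0 j))
      (trans (calibrated-gap a b (toℕ q)) (trans (ℤ.m-n≡m⊖n (b + c) x) (ℤ.⊖-≥ (<⇒≤ x<b+c))))

  module _ {p n-1} (pp : Prime p) (cn<p : c * suc n-1 < p) (es : List (Index {suc n-1} {Fin (c + c)}))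
           (es-complete : ∀ {i j} → i Fin.< j → ∀ q → ((i , j) , q) ∈ˡ es)
           (es-sound : ∀ {i j q} → ((i , j) , q) ∈ˡ es → i Fin.< j) where

    private
      n = suc n-1
      m = c * n-1
      m+c≡cn : m + c ≡ c * n
      m+c≡cn = trans (+-comm m c) (sym (*-suc c n-1))

    nonvanishing⇒separated : ∀ v → ¬ + p ℤ.∣ gapProduct calibrated es v →
                             ∀ {i j} → i Fin.< j → Separated c (lookup v i) (lookup v j)
    nonvanishing⇒separated v p∤P {i} {j} i<j = decidable-stable (separated? _ _) λ ¬sep →
      let q , eq = non-separated ¬sep in
      p∤P (gapProduct-∣ {o = calibrated} {es} {(i , j) , q} {v} (es-complete i<j q)
        (subst (+ p ℤ.∣_) (sym (calibrated-gap≡0 v q eq)) (ℤ.∣ᵤ⇒∣ (p ℕ.∣0))))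

    calibrated-isolated : ¬ + p ℤ.∣ top n m (gapProduct calibrated es)
    calibrated-isolated = top-isolated pp n {f = gapProduct calibrated es} {progression c n 0}
      (≤-<-trans (*-monoʳ-≤ c (n≤1+n n-1)) cn<p)
      (λ i → ≤-trans (≤-reflexive (lookup-progression c 0 i)) (*-monoʳ-≤ c (≤-pred (Fin.toℕ<n i))))
      (gapProduct-∤ {o = calibrated} {es} pp λ {((i , j) , q)} e∈ → progression-gap-∤ cn<p (es-sound e∈) q)
      -- The `n` segments of a grid point lie in `[0, m + c)`, whose length is exactly `c * n`, so
      -- separated segments pack it tightly.
      λ v v≤m v≢w → decidable-stable (+ p ℤ.∣? gapProduct calibrated es v) λ p∤P → v≢w
        (tight-packing c v (toList-AllPairs⁺ v (nonvanishing⇒separated v p∤P))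
          (toList-All⁺ v (λ i → z≤n , +-monoˡ-≤ c (v≤m i))) (≤-reflexive m+c≡cn))

    -- Combinatorial Nullstellensatz: the number of factors is `n * m`, so the products for `o` and
    -- for `calibrated` have the same `top`. It is nonzero mod `p`, hence so is some value of the
    -- product for `o`.
    nonvanishing-point : length es ≡ n * m → ∀ o → ∃ λ t → ¬ + p ℤ.∣ gapProduct o es t
    nonvanishing-point length-es o = top-∤ p n m {gapProduct o es} (subst (λ z → ¬ + p ℤ.∣ z)
      (sym (top-determined n m {gapProduct o es} {gapProduct calibrated es}
        (subst ((λ v → gapProduct o es v ℤ.- gapProduct calibrated es v) hasDegree<_) length-es
          (gapProduct-offsets o calibrated es))))
      calibrated-isolated)

-- Shifts avoiding prescribed differences

constraints : ∀ n c → List (Index {n} {Fin (c + c)})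
constraints n c = cartesianProduct (orderedPairs n) (allFin (c + c))

length-constraints : ∀ n c → length (constraints n c) ≡ n * (c * pred n)
length-constraints n c = trans (length-cartesianProduct (orderedPairs n) (allFin (c + c)))
  (trans (cong (length (orderedPairs n) *_) (length-tabulate {n = c + c} _))
    (trans (double (length (orderedPairs n)) c) (trans (cong (_* c) (length-orderedPairs n)) (reorder n (pred n) c))))
  where
  double : ∀ l c → l * (c + c) ≡ l * 2 * c
  double = ℕSolver.solve-∀
  reorder : ∀ a b c → a * b * c ≡ a * (c * b)
  reorder = ℕSolver.solve-∀

-- The values `D i j q` serve as offsets of the gaps; where the product is nonzero mod `p`, no
-- factor is divisible by `p`.
avoidance : ∀ {p} → Prime p → ∀ n c → c * n < p → (D : Fin n → Fin n → Fin (c + c) → ℤ) →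
            ∃ λ (t : Vec ℕ n) → ∀ {i j} → i Fin.< j → ∀ q → ¬ + p ℤ.∣ + lookup t j ℤ.- + lookup t i ℤ.+ D i j q
avoidance     pp zero    c cn<p D = [] , λ {}
avoidance {p} pp (suc n) c cn<p D = proj₁ point , λ {i} {j} i<j q p∣gap →
  proj₂ point (gapProduct-∣ {o = o} {constraints (suc n) c} {(i , j) , q} {proj₁ point} (complete i<j q) p∣gap)
  where
  o : Index {suc n} {Fin (c + c)} → ℤ
  o ((i , j) , q) = D i j q
  complete : ∀ {i j} → i Fin.< j → ∀ q → ((i , j) , q) ∈ˡ constraints (suc n) c
  complete i<j q = ∈-cartesianProduct⁺ (∈-orderedPairs⁺ i<j) (∈-allFin q)
  point = nonvanishing-point c pp cn<p (constraints (suc n) c) complete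
    (λ e∈ → ∈-orderedPairs⁻ (suc n) (proj₁ (∈-cartesianProduct⁻ (orderedPairs (suc n)) _ e∈)))
    (length-constraints (suc n) c) o

-- Translates and orbits

private
  variable
    A : Set
    xs ys zs : List A

unique-set⇒↭ : Unique xs → Unique ys → (∀ {x} → x ∈ˡ xs → x ∈ˡ ys) → (∀ {x} → x ∈ˡ ys → x ∈ˡ xs) → xs ↭ ys
unique-set⇒↭ xs! ys! xs⊆ys ys⊆xs = ∼bag⇒↭ (unique∧set⇒bag xs! ys! (mk⇔ xs⊆ys ys⊆xs))

-- Serves both to split an orbit off the list of blocks and to bound the length of a duplicate-free
-- list over `Fin v`.
unique-extract : Unique xs → (∀ {x} → x ∈ˡ xs → x ∈ˡ ys) → ∃ λ rest → ys ↭ xs ++ rest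
unique-extract {xs = []}     {ys} _ _ = ys , ↭-refl
unique-extract {xs = x ∷ xs} (x∉xs ∷ xs!) xs⊆ys with ∈-∃++ (xs⊆ys (here refl))
... | us , vs , refl with unique-extract xs! (λ y∈xs → remove y∈xs (∈-resp-↭ (shift x us vs) (xs⊆ys (there y∈xs))))
  where
  remove : ∀ {y} → y ∈ˡ xs → y ∈ˡ x ∷ us ++ vs → y ∈ˡ us ++ vs
  remove y∈xs (here refl) = contradiction y∈xs (Unique.Unique[x∷xs]⇒x∉xs (x∉xs ∷ xs!))
  remove y∈xs (there y∈)  = y∈
...   | rest , perm = rest , ↭-trans (shift x us vs) (↭-prep x perm)

++-cancelˡ-↭ : ∀ (xs : List A) → xs ++ ys ↭ xs ++ zs → ys ↭ zs
++-cancelˡ-↭ []       perm = perm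
++-cancelˡ-↭ (x ∷ xs) perm = ++-cancelˡ-↭ xs (drop-∷ perm)

module _ {v : ℕ} .{{_ : NonZero v}} where

  toℕ-mod : ∀ m → toℕ (m mod v) ≡ m % v
  toℕ-mod m = Fin.toℕ-fromℕ< (m%n<n m v)

  mod-cong : ∀ {m n} → m % v ≡ n % v → m mod v ≡ n mod v
  mod-cong eq = Fin.toℕ-injective (trans (toℕ-mod _) (trans eq (sym (toℕ-mod _))))

  mod-toℕ : ∀ (x : Fin v) → toℕ x mod v ≡ x
  mod-toℕ x = Fin.toℕ-injective (trans (toℕ-mod (toℕ x)) (m<n⇒m%n≡m (Fin.toℕ<n x)))

  %-+ˡ : ∀ m n → (m % v + n) % v ≡ (m + n) % v
  %-+ˡ m n = trans (%-distribˡ-+ (m % v) n v)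
    (trans (cong (λ r → (r + n % v) % v) (m%n%n≡m%n m v)) (sym (%-distribˡ-+ m n v)))

  %-+ʳ : ∀ m n → (m + n % v) % v ≡ (m + n) % v
  %-+ʳ m n = trans (cong (_% v) (+-comm m (n % v))) (trans (%-+ˡ n m) (cong (_% v) (+-comm n m)))

  mod-⊕ : ∀ m n → (m mod v) ⊕ (n mod v) ≡ (m + n) mod v
  mod-⊕ m n = mod-cong (trans (cong₂ (λ a b → (a + b) % v) (toℕ-mod m) (toℕ-mod n)) (trans (%-+ˡ m (n % v)) (%-+ʳ m n)))

  ⊕-comm : ∀ (x y : Fin v) → x ⊕ y ≡ y ⊕ x
  ⊕-comm x y = cong (_mod v) (+-comm (toℕ x) (toℕ y))

  ⊕-assoc : ∀ (x y z : Fin v) → (x ⊕ y) ⊕ z ≡ x ⊕ (y ⊕ z)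
  ⊕-assoc x y z = mod-cong (begin
    (toℕ (x ⊕ y) + toℕ z) % v           ≡⟨ cong (λ a → (a + toℕ z) % v) (toℕ-mod _) ⟩
    ((toℕ x + toℕ y) % v + toℕ z) % v   ≡⟨ %-+ˡ (toℕ x + toℕ y) (toℕ z) ⟩
    (toℕ x + toℕ y + toℕ z) % v         ≡⟨ cong (_% v) (+-assoc (toℕ x) (toℕ y) (toℕ z)) ⟩
    (toℕ x + (toℕ y + toℕ z)) % v       ≡⟨ %-+ʳ (toℕ x) (toℕ y + toℕ z) ⟨
    (toℕ x + (toℕ y + toℕ z) % v) % v   ≡⟨ cong (λ a → (toℕ x + a) % v) (toℕ-mod _) ⟨
    (toℕ x + toℕ (y ⊕ z)) % v           ∎)
    where open ≡-Reasoning

  ⊖-⊕ : ∀ (x y : Fin v) → (x ⊖ y) ⊕ y ≡ x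
  ⊖-⊕ x y = trans (mod-cong (begin
    (toℕ (x ⊖ y) + toℕ y) % v               ≡⟨ cong (λ a → (a + toℕ y) % v) (toℕ-mod _) ⟩
    ((toℕ x + (v ∸ toℕ y)) % v + toℕ y) % v ≡⟨ %-+ˡ (toℕ x + (v ∸ toℕ y)) (toℕ y) ⟩
    (toℕ x + (v ∸ toℕ y) + toℕ y) % v       ≡⟨ cong (_% v) (+-assoc (toℕ x) (v ∸ toℕ y) (toℕ y)) ⟩
    (toℕ x + (v ∸ toℕ y + toℕ y)) % v       ≡⟨ cong (λ a → (toℕ x + a) % v) (m∸n+n≡m (<⇒≤ (Fin.toℕ<n y))) ⟩
    (toℕ x + v) % v                         ≡⟨ [m+n]%n≡m%n (toℕ x) v ⟩
    toℕ x % v                               ∎)) (mod-toℕ x)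
    where open ≡-Reasoning

  ⊕-⊖ : ∀ (x y : Fin v) → (x ⊕ y) ⊖ y ≡ x
  ⊕-⊖ x y = trans (mod-cong (begin
    (toℕ (x ⊕ y) + (v ∸ toℕ y)) % v         ≡⟨ cong (λ a → (a + (v ∸ toℕ y)) % v) (toℕ-mod _) ⟩
    ((toℕ x + toℕ y) % v + (v ∸ toℕ y)) % v ≡⟨ %-+ˡ (toℕ x + toℕ y) (v ∸ toℕ y) ⟩
    (toℕ x + toℕ y + (v ∸ toℕ y)) % v       ≡⟨ cong (_% v) (+-assoc (toℕ x) (toℕ y) (v ∸ toℕ y)) ⟩
    (toℕ x + (toℕ y + (v ∸ toℕ y))) % v     ≡⟨ cong (λ a → (toℕ x + a) % v) (m+[n∸m]≡n (<⇒≤ (Fin.toℕ<n y))) ⟩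
    (toℕ x + v) % v                         ≡⟨ [m+n]%n≡m%n (toℕ x) v ⟩
    toℕ x % v                               ∎)) (mod-toℕ x)
    where open ≡-Reasoning

  ⊕-cancelʳ : ∀ {x y} (z : Fin v) → x ⊕ z ≡ y ⊕ z → x ≡ y
  ⊕-cancelʳ {x} {y} z eq = trans (sym (⊕-⊖ x z)) (trans (cong (_⊖ z) eq) (⊕-⊖ y z))

  ⊖-unique : ∀ {x y z : Fin v} → x ⊕ y ≡ z → x ≡ z ⊖ y
  ⊖-unique {x} {y} eq = trans (sym (⊕-⊖ x y)) (cong (_⊖ y) eq)

  ⊖-⊖ : ∀ (x t s : Fin v) → (x ⊖ t) ⊖ s ≡ x ⊖ (s ⊕ t)
  ⊖-⊖ x t s = ⊖-unique (trans (sym (⊕-assoc ((x ⊖ t) ⊖ s) s t)) (trans (cong (_⊕ t) (⊖-⊕ (x ⊖ t) s)) (⊖-⊕ x t)))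

  lookup-translate : ∀ t (B : Subset v) x → lookup (translate t B) x ≡ lookup B (x ⊖ t)
  lookup-translate t B = lookup∘tabulate _

  translate-∘ : ∀ t s (B : Subset v) → translate t (translate s B) ≡ translate (s ⊕ t) B
  translate-∘ t s B = tabulate-cong λ x → trans (lookup-translate s B (x ⊖ t)) (cong (lookup B) (⊖-⊖ x t s))

  -- Indexed by all shifts, hence with repetitions if `B` has a nontrivial stabilizer; `development`
  -- is then the concatenation of the orbits.
  orbit : Subset v → List (Subset v)
  orbit B = map (λ t → translate t B) (allFin v)

  map-allFin-↭ : ∀ (f g : Fin v → Fin v) → (∀ t → f (g t) ≡ t) → (∀ {s t} → f s ≡ f t → s ≡ t) →
                 map f (allFin v) ↭ allFin v
  map-allFin-↭ f g fg≡id f-inj = unique-set⇒↭ (Unique.map⁺ f-inj (Unique.allFin⁺ v)) (Unique.allFin⁺ v)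
    (λ _ → ∈-allFin _) (λ {t} _ → subst (_∈ˡ map f (allFin v)) (fg≡id t) (∈-map⁺ f (∈-allFin (g t))))

  -- The substitution `t ↦ t ⊕ s` permutes the shifts. This is why base blocks can be moved without
  -- changing the design they generate.
  orbit-translate : ∀ s B → orbit (translate s B) ↭ orbit B
  orbit-translate s B = ↭-trans
    (↭-reflexive (trans
      (map-cong (λ t → trans (translate-∘ t s B) (cong (λ u → translate u B) (⊕-comm s t))) (allFin v))
      (map-∘ (allFin v))))
    (↭-map⁺ (λ t → translate t B) (map-allFin-↭ (_⊕ s) (_⊖ s) (λ t → ⊖-⊕ t s) (⊕-cancelʳ s)))

  translate-orbit : ∀ s B → map (translate s) (orbit B) ↭ orbit B
  translate-orbit s B = ↭-trans
    (↭-reflexive (trans (sym (map-∘ (allFin v)))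
      (trans (map-cong (λ t → translate-∘ s t B) (allFin v)) (map-∘ (allFin v)))))
    (↭-map⁺ (λ t → translate t B) (map-allFin-↭ (_⊕ s) (_⊖ s) (λ t → ⊖-⊕ t s) (⊕-cancelʳ s)))

  private
    -- By invariance `𝓑` contains every translate of its first block; these are distinct, so the
    -- orbit splits off up to permutation. The rest is again invariant, since `𝓑` and the orbit are,
    -- and it is shorter because `v ≥ 1`.
    generators-bounded : ∀ N (𝓑 : List (Subset v)) → length 𝓑 ≤ N → All (Unique ∘ orbit) 𝓑 →
                      (∀ t → map (translate t) 𝓑 ↭ 𝓑) → ∃ λ 𝓕 → 𝓕 Generates 𝓑
    generators-bounded N       []      _ _ _ = [] , ↭-refl
    generators-bounded (suc N) 𝓑@(B ∷ 𝓑₀) (s≤s len≤) full@(B-full ∷ _) inv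
      with unique-extract B-full (λ D∈ → let t , _ , D≡ = ∈-map⁻ _ D∈ in
             subst (_∈ˡ 𝓑) (sym D≡) (∈-resp-↭ (inv t) (here refl)))
    ... | rest , 𝓑↭ with generators-bounded N rest rest≤ (All.++⁻ʳ (orbit B) (All-resp-↭ 𝓑↭ full)) rest-inv
      where
      rest≤ : length rest ≤ N
      rest≤ = ≤-trans (≤-pred (begin
        suc (length rest)
          ≤⟨ +-monoˡ-≤ (length rest) (>-nonZero⁻¹ v) ⟩
        v + length rest
          ≡⟨ cong (_+ length rest) (trans (length-map _ (allFin v)) (length-tabulate {n = v} _)) ⟨
        length (orbit B) + length rest
          ≡⟨ length-++ (orbit B) ⟨
        length (orbit B ++ rest)
          ≡⟨ ↭-length 𝓑↭ ⟨
        length 𝓑 ∎)) len≤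
        where open ≤-Reasoning
      rest-inv : ∀ t → map (translate t) rest ↭ rest
      rest-inv t = ++-cancelˡ-↭ (orbit B) (begin
        orbit B ++ map (translate t) rest                   ↭⟨ ++⁺ʳ _ (translate-orbit t B) ⟨
        map (translate t) (orbit B) ++ map (translate t) rest ≡⟨ map-++ (translate t) (orbit B) rest ⟨
        map (translate t) (orbit B ++ rest)                 ↭⟨ ↭-map⁺ (translate t) 𝓑↭ ⟨
        map (translate t) 𝓑                                 ↭⟨ inv t ⟩
        𝓑                                                   ↭⟨ 𝓑↭ ⟩
        orbit B ++ rest                                     ∎)
        where open PermutationReasoning
    ...   | 𝓕 , gen = B ∷ 𝓕 , ↭-trans (++⁺ˡ (orbit B) gen) (↭-sym 𝓑↭)

  generators : ∀ (𝓑 : List (Subset v)) → All (Unique ∘ orbit) 𝓑 → (∀ t → map (translate t) 𝓑 ↭ 𝓑) →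
               ∃ λ 𝓕 → 𝓕 Generates 𝓑
  generators 𝓑 = generators-bounded (length 𝓑) 𝓑 ≤-refl

-- Periodic sequences and full orbits

module _ {A : Set} (q : ℕ → A) where

  IsPeriod : ℕ → Set
  IsPeriod e = ∀ n → q (n + e) ≡ q n

  period-* : ∀ x {e} → IsPeriod e → IsPeriod (x * e)
  period-* zero    per n = cong q (+-identityʳ n)
  period-* (suc x) {e} per n = trans (cong q (sym (+-assoc n e (x * e)))) (trans (period-* x per (n + e)) (per n))

  period-1+ : ∀ {e f} → IsPeriod e → IsPeriod f → 1 + e ≡ f → IsPeriod 1
  period-1+ {e} per-e per-f refl n = trans (sym (per-e (n + 1))) (trans (cong q (+-assoc n 1 e)) (per-f n))

  period-1⇒constant : IsPeriod 1 → ∀ n → q n ≡ q 0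
  period-1⇒constant per zero    = refl
  period-1⇒constant per (suc n) = trans (cong q (+-comm 1 n)) (trans (per n) (period-1⇒constant per n))

  -- Bézout gives multiples of `d` and `e` that differ by 1, and both are periods. The two cases
  -- tell which multiple is larger.
  coprime-periods : ∀ {d e} → Bézout.Identity 1 d e → IsPeriod d → IsPeriod e → IsPeriod 1
  coprime-periods (Bézout.+- x y eq) per-d per-e = period-1+ (period-* y per-e) (period-* x per-d) eq
  coprime-periods (Bézout.-+ x y eq) per-d per-e = period-1+ (period-* x per-d) (period-* y per-e) eq

module _ {p : ℕ} .{{_ : NonZero p}} (pp : Prime p) where

  constant⇒size : ∀ (B : Subset p) b → (∀ x → lookup B x ≡ b) → ∣ B ∣ ≡ 0 ⊎ ∣ B ∣ ≡ p
  constant⇒size B b B≡b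
    with trans (sym (tabulate∘lookup B))
           (trans (tabulate-cong λ x → trans (B≡b x) (sym (lookup-replicate x b))) (tabulate∘lookup (replicate p b)))
  constant⇒size B true  B≡b | refl = inj₂ (∣⊤∣≡n p)
  constant⇒size B false B≡b | refl = inj₁ (∣⊥∣≡0 p)

  -- Membership read along 0, 1, 2, ... mod `p` has the periods `p` and `d`, coprime since `p` is
  -- prime and `0 < d < p`. So it is constant, and `B` is empty or everything.
  invariant⇒size : ∀ (B : Subset p) d → toℕ d ≢ 0 → (∀ y → lookup B (y ⊕ d) ≡ lookup B y) → ∣ B ∣ ≡ 0 ⊎ ∣ B ∣ ≡ p
  invariant⇒size B d d≢0 inv = constant⇒size B (q 0) λ x →
    trans (cong (lookup B) (sym (mod-toℕ x))) (period-1⇒constant q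
      (coprime-periods q (coprime-Bézout (prime⇒coprime pp ⦃ ≢-nonZero d≢0 ⦄ (Fin.toℕ<n d))) period-p period-d) (toℕ x))
    where
    q : ℕ → Bool
    q n = lookup B (n mod p)
    period-d : IsPeriod q (toℕ d)
    period-d n = trans (cong (lookup B) (trans (sym (mod-⊕ n (toℕ d))) (cong (n mod p ⊕_) (mod-toℕ d)))) (inv (n mod p))
    period-p : IsPeriod q p
    period-p n = cong (lookup B) (mod-cong ([m+n]%n≡m%n n p))

  -- If the translates by `s` and `t` agree, `B` is invariant under `t ⊖ s`; were this nonzero, `B`
  -- would be empty or all of `Fin p`.
  orbit-unique : ∀ B → ∣ B ∣ ≢ 0 → ∣ B ∣ ≢ p → Unique (orbit B)
  orbit-unique B ∣B∣≢0 ∣B∣≢p = Unique.map⁺ translate-injective (Unique.allFin⁺ p)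
    where
    translate-injective : ∀ {s t} → translate s B ≡ translate t B → s ≡ t
    translate-injective {s} {t} eq = decidable-stable (s Fin.≟ t) λ s≢t →
      impossible (invariant⇒size B (t ⊖ s) (d≢0 s≢t) inv)
      where
      impossible : ¬ (∣ B ∣ ≡ 0 ⊎ ∣ B ∣ ≡ p)
      impossible (inj₁ e) = ∣B∣≢0 e
      impossible (inj₂ e) = ∣B∣≢p e
      d≢0 : s ≢ t → toℕ (t ⊖ s) ≢ 0
      d≢0 s≢t d≡0 = s≢t (trans (sym (mod-toℕ s)) (trans (cong (λ d → (d + toℕ s) mod p) (sym d≡0)) (⊖-⊕ t s)))
      inv : ∀ y → lookup B (y ⊕ (t ⊖ s)) ≡ lookup B y
      inv y = begin
        lookup B (y ⊕ (t ⊖ s))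
          ≡⟨ cong (lookup B) (⊖-unique (trans (⊕-assoc y (t ⊖ s) s) (cong (y ⊕_) (⊖-⊕ t s)))) ⟩
        lookup B ((y ⊕ t) ⊖ s)         ≡⟨ lookup-translate s B (y ⊕ t) ⟨
        lookup (translate s B) (y ⊕ t) ≡⟨ cong (λ D → lookup D (y ⊕ t)) eq ⟩
        lookup (translate t B) (y ⊕ t) ≡⟨ lookup-translate t B (y ⊕ t) ⟩
        lookup B ((y ⊕ t) ⊖ t)         ≡⟨ cong (lookup B) (⊕-⊖ y t) ⟩
        lookup B y                     ∎
        where open ≡-Reasoning

-- Counting differences

length-filter-map : ∀ {A B : Set} {P : B → Set} (P? : Decidable P) (f : A → B) xs →
                    length (filter P? (map f xs)) ≡ length (filter (P? ∘ f) xs)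
length-filter-map P? f []       = refl
length-filter-map P? f (x ∷ xs) with P? (f x)
... | yes _ = cong suc (length-filter-map P? f xs)
... | no  _ = length-filter-map P? f xs

length-filter-++ : ∀ {A : Set} {P : A → Set} (P? : Decidable P) xs ys →
                   length (filter P? (xs ++ ys)) ≡ length (filter P? xs) + length (filter P? ys)
length-filter-++ P? xs ys = trans (cong length (filter-++ P? xs ys)) (length-++ (filter P? xs))

length-elements : ∀ {v} (F : Subset v) → length (elements F) ≡ ∣ F ∣
length-elements []      = refl
length-elements {suc v} (b ∷ F) = head b (trans
  (cong (λ l → length (filter (_∈? (b ∷ F)) l)) (sym (map-tabulate {n = v} (λ i → i) suc)))
  (trans (length-filter-map (_∈? (b ∷ F)) suc (allFin v))
    (trans
      (cong length (filter-≐ (λ x → suc x ∈? (b ∷ F)) (_∈? F) (drop-there , λ x∈F → Vec.there x∈F) (allFin v)))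
      (length-elements F))))
  where
  head : ∀ b → length (filter (_∈? (b ∷ F)) (List.tabulate suc)) ≡ ∣ F ∣ →
         length (filter (_∈? (b ∷ F)) (allFin (suc v))) ≡ ∣ b ∷ F ∣
  head true  eq = cong suc eq
  head false eq = eq

module _ {v : ℕ} where

  ∈-elements⁺ : ∀ {F : Subset v} {x} → x ∈ F → x ∈ˡ elements F
  ∈-elements⁺ {F} {x} = ∈-filter⁺ (_∈? F) (∈-allFin x)

  ∈-elements⁻ : ∀ {F : Subset v} {x} → x ∈ˡ elements F → x ∈ F
  ∈-elements⁻ {F} = proj₂ ∘ ∈-filter⁻ (_∈? F) {xs = allFin v}

  elements-unique : ∀ (F : Subset v) → Unique (elements F)
  elements-unique F = Unique.filter⁺ (_∈? F) (Unique.allFin⁺ v)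

  multiplicity-∷-≤ : ∀ d x (xs : List (Fin v)) → multiplicity d xs ≤ multiplicity d (x ∷ xs)
  multiplicity-∷-≤ d x xs with d Fin.≟ x
  ... | yes _ = n≤1+n _
  ... | no  _ = ≤-refl

  multiplicity≤1⇒Unique : ∀ (xs : List (Fin v)) → (∀ d → multiplicity d xs ≤ 1) → Unique xs
  multiplicity≤1⇒Unique []       _  = []
  multiplicity≤1⇒Unique (x ∷ xs) ≤1 =
    All.tabulate (λ y∈xs x≡y → <⇒≱ (s≤s (filter-some (x Fin.≟_) (lose y∈xs x≡y)))
      (subst (_≤ 1) (cong length (filter-accept (x Fin.≟_) refl)) (≤1 x)))
    ∷ multiplicity≤1⇒Unique xs λ d → ≤-trans (multiplicity-∷-≤ d x xs) (≤1 d)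

  length-unique-≤ : ∀ {xs : List (Fin v)} → Unique xs → length xs ≤ v
  length-unique-≤ {xs} xs! with unique-extract xs! (λ {x} _ → ∈-allFin x)
  ... | rest , perm = begin
    length xs                ≤⟨ m≤m+n _ _ ⟩
    length xs + length rest  ≡⟨ length-++ xs ⟨
    length (xs ++ rest)      ≡⟨ ↭-length perm ⟨
    length (allFin v)        ≡⟨ length-tabulate {n = v} _ ⟩
    v                        ∎
    where open ≤-Reasoning

length-off-diagonal : ∀ {v} (xs : List (Fin v)) → Unique xs →
  length (filter (λ (x , y) → ¬? (x Fin.≟ y)) (cartesianProduct xs xs)) ≡ length xs * length xs ∸ length xs
length-off-diagonal xs xs! = begin
  length off                                           ≡⟨ m+n∸m≡n (length xs) (length off) ⟨
  length xs + length off ∸ length xs                   ≡⟨ cong (λ l → l + length off ∸ length xs) length-diagonal ⟨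
  length (filter diagonal? xs²) + length off ∸ length xs
    ≡⟨ cong (_∸ length xs) (length-filter-∁ diagonal? xs²) ⟩
  length xs² ∸ length xs                               ≡⟨ cong (_∸ length xs) (length-cartesianProduct xs xs) ⟩
  length xs * length xs ∸ length xs                    ∎
  where
  open ≡-Reasoning
  xs² = cartesianProduct xs xs
  Diagonal : Fin _ × Fin _ → Set
  Diagonal (x , y) = x ≡ y
  diagonal? : Decidable Diagonal
  diagonal? (x , y) = x Fin.≟ y
  off = filter (∁? diagonal?) xs²
  to : ∀ {z} → z ∈ˡ filter diagonal? xs² → z ∈ˡ map (λ x → x , x) xs
  to z∈ with ∈-filter⁻ diagonal? {xs = xs²} z∈
  ... | z∈xs² , refl = ∈-map⁺ _ (proj₁ (∈-cartesianProduct⁻ xs xs z∈xs²))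
  from : ∀ {z} → z ∈ˡ map (λ x → x , x) xs → z ∈ˡ filter diagonal? xs²
  from z∈ with ∈-map⁻ _ z∈
  ... | x , x∈xs , refl = ∈-filter⁺ diagonal? (∈-cartesianProduct⁺ x∈xs x∈xs) refl
  length-diagonal : length (filter diagonal? xs²) ≡ length xs
  length-diagonal = trans (↭-length (unique-set⇒↭ (Unique.filter⁺ diagonal? (Unique.cartesianProduct⁺ xs! xs!))
    (Unique.map⁺ (cong proj₁) xs!) to from)) (length-map _ xs)

module _ {v : ℕ} .{{_ : NonZero v}} where

  𝟘 : Fin v
  𝟘 = 0 mod v

  toℕ-𝟘 : toℕ 𝟘 ≡ 0
  toℕ-𝟘 = trans (toℕ-mod 0) (m<n⇒m%n≡m (>-nonZero⁻¹ v))

  ⊕-identityʳ : ∀ (x : Fin v) → x ⊕ 𝟘 ≡ x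
  ⊕-identityʳ x = trans (cong (λ n → (toℕ x + n) mod v) toℕ-𝟘) (trans (cong (_mod v) (+-identityʳ (toℕ x))) (mod-toℕ x))

  ⊖-self : ∀ (x : Fin v) → x ⊖ x ≡ 𝟘
  ⊖-self x = sym (⊖-unique (trans (⊕-comm 𝟘 x) (⊕-identityʳ x)))

  ⊖-≢ : ∀ {x y d : Fin v} → toℕ d ≢ 0 → d ≡ x ⊖ y → x ≢ y
  ⊖-≢ {x} d≢0 d≡ refl = d≢0 (trans (cong toℕ (trans d≡ (⊖-self x))) toℕ-𝟘)

  𝟘⊖-involutive : ∀ (y : Fin v) → 𝟘 ⊖ (𝟘 ⊖ y) ≡ y
  𝟘⊖-involutive y = sym (⊖-unique (trans (⊕-comm y (𝟘 ⊖ y)) (⊖-⊕ 𝟘 y)))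

  ⊖-shift : ∀ (d t : Fin v) → (d ⊖ t) ⊖ (𝟘 ⊖ t) ≡ d
  ⊖-shift d t = sym (⊖-unique (⊕-cancelʳ t (trans (⊕-assoc d (𝟘 ⊖ t) t)
    (trans (cong (d ⊕_) (⊖-⊕ 𝟘 t)) (trans (⊕-identityʳ d) (sym (⊖-⊕ d t)))))))

  ⊖-recover : ∀ (x y : Fin v) → (x ⊖ y) ⊖ (𝟘 ⊖ y) ≡ x
  ⊖-recover x y = trans (⊖-⊖ x y (𝟘 ⊖ y)) (trans (cong (x ⊖_) (⊖-⊕ 𝟘 y)) (sym (⊖-unique (⊕-identityʳ x))))

  ∈-translate⁺ : ∀ t {B : Subset v} {x} → x ⊖ t ∈ B → x ∈ translate t B
  ∈-translate⁺ t {B} {x} x∈ = lookup⇒[]= x _ (trans (lookup-translate t B x) ([]=⇒lookup x∈))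

  ∈-translate⁻ : ∀ t {B : Subset v} {x} → x ∈ translate t B → x ⊖ t ∈ B
  ∈-translate⁻ t {B} {x} x∈ = lookup⇒[]= (x ⊖ t) B (trans (sym (lookup-translate t B x)) ([]=⇒lookup x∈))

  translate-𝟘 : ∀ (B : Subset v) → translate 𝟘 B ≡ B
  translate-𝟘 B = trans (tabulate-cong λ x → cong (lookup B) (sym (⊖-unique (⊕-identityʳ x)))) (tabulate∘lookup B)

  -- The translates F + t through d and 0 correspond to the pairs (d - t, - t) of F with difference d.
  multiplicity-differences : ∀ {d} → toℕ d ≢ 0 → ∀ F →
    multiplicity d (differences F) ≡ length (blocksThrough d 𝟘 (orbit F))
  multiplicity-differences {d} d≢0 F = begin
    multiplicity d (differences F)
      ≡⟨ length-filter-map (d Fin.≟_) (uncurry _⊖_) off ⟩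
    length (filter difference? off)
      ≡⟨ ↭-length perm ⟨
    length (map pair (filter through? (allFin v)))
      ≡⟨ length-map pair (filter through? (allFin v)) ⟩
    length (filter through? (allFin v))
      ≡⟨ length-filter-map (λ B → (d ∈? B) ×-dec (𝟘 ∈? B)) (λ t → translate t F) (allFin v) ⟨
    length (blocksThrough d 𝟘 (orbit F)) ∎
    where
    open ≡-Reasoning
    distinct? : Decidable {A = Fin v × Fin v} λ (x , y) → x ≢ y
    distinct? (x , y) = ¬? (x Fin.≟ y)
    F² = cartesianProduct (elements F) (elements F)
    off = filter distinct? F²
    difference? : Decidable {A = Fin v × Fin v} λ (x , y) → d ≡ x ⊖ y
    difference? (x , y) = d Fin.≟ (x ⊖ y)
    through? : Decidable λ t → d ∈ translate t F × 𝟘 ∈ translate t F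
    through? t = (d ∈? translate t F) ×-dec (𝟘 ∈? translate t F)
    pair : Fin v → Fin v × Fin v
    pair t = d ⊖ t , 𝟘 ⊖ t
    pair-injective : ∀ {s t} → pair s ≡ pair t → s ≡ t
    pair-injective {s} {t} eq = trans (sym (𝟘⊖-involutive s)) (trans (cong (𝟘 ⊖_) (cong proj₂ eq)) (𝟘⊖-involutive t))
    to : ∀ {z} → z ∈ˡ map pair (filter through? (allFin v)) → z ∈ˡ filter difference? off
    to z∈ with ∈-map⁻ pair z∈
    ... | t , t∈ , refl with ∈-filter⁻ through? {xs = allFin v} t∈
    ...   | _ , d∈ , 𝟘∈ = ∈-filter⁺ difference?
      (∈-filter⁺ distinct? (∈-cartesianProduct⁺ (∈-elements⁺ (∈-translate⁻ t d∈)) (∈-elements⁺ (∈-translate⁻ t 𝟘∈)))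
        (⊖-≢ d≢0 (sym (⊖-shift d t)))) (sym (⊖-shift d t))
    from : ∀ {z} → z ∈ˡ filter difference? off → z ∈ˡ map pair (filter through? (allFin v))
    from {x , y} z∈ with ∈-filter⁻ difference? {xs = off} z∈
    ... | z∈off , d≡
      with ∈-cartesianProduct⁻ (elements F) (elements F) (proj₁ (∈-filter⁻ distinct? {xs = F²} z∈off))
    ...   | x∈ , y∈ = subst (_∈ˡ map pair (filter through? (allFin v))) (cong₂ _,_ d⊖t≡x (𝟘⊖-involutive y))
      (∈-map⁺ pair (∈-filter⁺ through? (∈-allFin (𝟘 ⊖ y))
        (∈-translate⁺ (𝟘 ⊖ y) (subst (_∈ F) (sym d⊖t≡x) (∈-elements⁻ x∈)) ,
         ∈-translate⁺ (𝟘 ⊖ y) (subst (_∈ F) (sym (𝟘⊖-involutive y)) (∈-elements⁻ y∈)))))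
      where
      d⊖t≡x : d ⊖ (𝟘 ⊖ y) ≡ x
      d⊖t≡x = trans (cong (_⊖ (𝟘 ⊖ y)) d≡) (⊖-recover x y)
    perm : map pair (filter through? (allFin v)) ↭ filter difference? off
    perm = unique-set⇒↭ (Unique.map⁺ pair-injective (Unique.filter⁺ through? (Unique.allFin⁺ v)))
      (Unique.filter⁺ difference? (Unique.filter⁺ distinct?
        (Unique.cartesianProduct⁺ (elements-unique F) (elements-unique F)))) to from

  multiplicity-development : ∀ {d} → toℕ d ≢ 0 → ∀ 𝓕 →
    multiplicity d (concatMap differences 𝓕) ≡ length (blocksThrough d 𝟘 (development 𝓕))
  multiplicity-development     d≢0 []      = refl
  multiplicity-development {d} d≢0 (F ∷ 𝓕) = trans
    (length-filter-++ (d Fin.≟_) (differences F) (concatMap differences 𝓕))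
    (trans (cong₂ _+_ (multiplicity-differences d≢0 F) (multiplicity-development d≢0 𝓕))
      (sym (length-filter-++ (λ B → (d ∈? B) ×-dec (𝟘 ∈? B)) (orbit F) (development 𝓕))))

  All-development⁻ : ∀ {P : Subset v → Set} 𝓕 → All P (development 𝓕) → All P 𝓕
  All-development⁻     []      _ = []
  All-development⁻ {P} (F ∷ 𝓕) all =
    subst P (translate-𝟘 F) (All.lookup (All.++⁻ˡ (orbit F) all) (∈-map⁺ _ (∈-allFin 𝟘)))
    ∷ All-development⁻ 𝓕 (All.++⁻ʳ (orbit F) all)

  -- A nonzero `d` occurs as a difference as often as `d` and `𝟘` lie in a common block, and the
  -- design fixes that number at `l`.
  generates⇒CDF : ∀ {k l} {𝓕 𝓑 : List (Subset v)} → 𝓕 Generates 𝓑 → IsDesign v k l 𝓑 → IsCDF v k l 𝓕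
  generates⇒CDF {𝓕 = 𝓕} gen des = record
    { blockSize = All-development⁻ 𝓕 (All-resp-↭ (↭-sym gen) (IsDesign.blockSize des))
    ; covers = λ d d≢0 → trans (multiplicity-development d≢0 𝓕)
        (trans (↭-length (filter-↭ (λ B → (d ∈? B) ×-dec (𝟘 ∈? B)) gen))
          (IsDesign.balanced des d 𝟘 λ d≡𝟘 → d≢0 (trans (cong toℕ d≡𝟘) toℕ-𝟘)))
    }

  length-differences : ∀ F → length (differences F) ≡ ∣ F ∣ * ∣ F ∣ ∸ ∣ F ∣
  length-differences F = trans
    (length-map _ (filter (λ (x , y) → ¬? (x Fin.≟ y)) (cartesianProduct (elements F) (elements F))))
    (trans (length-off-diagonal (elements F) (elements-unique F)) (cong (λ k → k * k ∸ k) (length-elements F)))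

  length-all-differences : ∀ {k 𝓕} → All (λ F → ∣ F ∣ ≡ k) 𝓕 →
                           length (concatMap differences 𝓕) ≡ (k * k ∸ k) * length 𝓕
  length-all-differences {k} []  = sym (*-zeroʳ (k * k ∸ k))
  length-all-differences {k} {F ∷ 𝓕} (refl ∷ sizes) = trans (length-++ (differences F))
    (trans (cong₂ _+_ (length-differences F) (length-all-differences sizes)) (sym (*-suc (k * k ∸ k) (length 𝓕))))

  differences-≢𝟘 : ∀ F → All (𝟘 ≢_) (differences F)
  differences-≢𝟘 F = All.map⁺ (All.map (λ {(x , y)} x≢y 𝟘≡ → x≢y
    (trans (sym (⊖-⊕ x y)) (trans (cong (_⊕ y) (sym 𝟘≡)) (trans (⊕-comm 𝟘 y) (⊕-identityʳ y)))))
    (All.all-filter (λ (x , y) → ¬? (x Fin.≟ y)) (cartesianProduct (elements F) (elements F))))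

  all-differences-≢𝟘 : ∀ 𝓕 → All (𝟘 ≢_) (concatMap differences 𝓕)
  all-differences-≢𝟘 []      = []
  all-differences-≢𝟘 (F ∷ 𝓕) = All.++⁺ (differences-≢𝟘 F) (all-differences-≢𝟘 𝓕)

  -- Each nonzero residue is a difference exactly once, so the differences are distinct; prepending
  -- `𝟘`, which is none of them, makes the bound strict.
  CDF-size : ∀ {k 𝓕} → IsCDF v k 1 𝓕 → (k * k ∸ k) * length 𝓕 < v
  CDF-size {k} {𝓕} cdf = subst (_< v) (length-all-differences (IsCDF.blockSize cdf))
    (length-unique-≤ (all-differences-≢𝟘 𝓕 ∷ multiplicity≤1⇒Unique (concatMap differences 𝓕) ≤1))
    where
    ≤1 : ∀ d → multiplicity d (concatMap differences 𝓕) ≤ 1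
    ≤1 d with toℕ d ≟ 0
    ... | no  d≢0 = ≤-reflexive (IsCDF.covers cdf d d≢0)
    ... | yes d≡0 = ≤-trans (≤-reflexive (cong length (filter-none (d Fin.≟_)
      (All.map (λ 𝟘≢x d≡x → 𝟘≢x (trans (Fin.toℕ-injective (trans toℕ-𝟘 (sym d≡0))) d≡x)) (all-differences-≢𝟘 𝓕))))) z≤n

  development-cong : ∀ {n} {f g : Fin n → Subset v} → (∀ i → orbit (f i) ↭ orbit (g i)) →
                     development (List.tabulate f) ↭ development (List.tabulate g)
  development-cong {zero}  f~g = ↭-refl
  development-cong {suc n} f~g = ↭-++⁺ (f~g zero) (development-cong (f~g ∘ suc))

  %-≡⇒∣ : ∀ {m n} → m % v ≡ n % v → + v ℤ.∣ + m ℤ.- + n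
  %-≡⇒∣ {m} {n} eq = ℤ.divides (+ (m / v) ℤ.- + (n / v)) (begin
    + m ℤ.- + n
      ≡⟨ cong₂ (λ a b → + a ℤ.- + b) (m≡m%n+[m/n]*n m v)
           (trans (m≡m%n+[m/n]*n n v) (cong (_+ n / v * v) (sym eq))) ⟩
    + (m % v + m / v * v) ℤ.- + (m % v + n / v * v)
      ≡⟨ cong₂ ℤ._-_ (split (m / v)) (split (n / v)) ⟩
    (+ (m % v) ℤ.+ + (m / v) ℤ.* + v) ℤ.- (+ (m % v) ℤ.+ + (n / v) ℤ.* + v)
      ≡⟨ ring (+ (m % v)) (+ (m / v)) (+ (n / v)) (+ v) ⟩
    (+ (m / v) ℤ.- + (n / v)) ℤ.* + v ∎)
    where
    open ≡-Reasoning
    split : ∀ q → + (m % v + q * v) ≡ + (m % v) ℤ.+ + q ℤ.* + v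
    split q = cong (ℤ._+_ (+ (m % v))) (ℤ.pos-* q v)
    ring : ∀ r a b v → (r ℤ.+ a ℤ.* v) ℤ.- (r ℤ.+ b ℤ.* v) ≡ (a ℤ.- b) ℤ.* v
    ring = solve-∀

  -- A common point satisfies `z = x + s = y + t` mod `v`. The conclusion is written over the
  -- integers in the shape of a gap with offset `y - x`.
  overlap⇒∣ : ∀ {F G : Subset v} s t {z} → z ∈ translate (s mod v) F → z ∈ translate (t mod v) G →
    ∃ λ x → ∃ λ y → x ∈ F × y ∈ G × + v ℤ.∣ + t ℤ.- + s ℤ.+ (+ toℕ y ℤ.- + toℕ x)
  overlap⇒∣ s t {z} z∈F z∈G = x , y , ∈-translate⁻ (s mod v) z∈F , ∈-translate⁻ (t mod v) z∈G ,
    subst (+ v ℤ.∣_) (regroup (+ toℕ y) (+ t) (+ toℕ x) (+ s)) (%-≡⇒∣ same)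
    where
    x = z ⊖ (s mod v)
    y = z ⊖ (t mod v)
    at : ∀ r → toℕ z ≡ (toℕ (z ⊖ (r mod v)) + r) % v
    at r = trans (cong toℕ (sym (⊖-⊕ z (r mod v))))
      (trans (toℕ-mod _)
        (trans (cong (λ a → (toℕ (z ⊖ (r mod v)) + a) % v) (toℕ-mod r)) (%-+ʳ (toℕ (z ⊖ (r mod v))) r)))
    same : (toℕ y + t) % v ≡ (toℕ x + s) % v
    same = trans (sym (at t)) (at s)
    regroup : ∀ y t x s → (y ℤ.+ t) ℤ.- (x ℤ.+ s) ≡ t ℤ.- s ℤ.+ (y ℤ.- x)
    regroup = solve-∀

-- Disjoint translates of the base blocks

enumerate : ∀ {A : Set} → A → ∀ {N} (xs : List A) → length xs ≤ N →
            ∃ λ (f : Fin N → A) → ∀ {x} → x ∈ˡ xs → ∃ λ q → f q ≡ x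
-- Labels left over receive the default value `a`; as offsets they only add constraints.
enumerate a []       _ = (λ _ → a) , λ ()
enumerate a (x ∷ xs) (s≤s len≤) with enumerate a xs len≤
... | f , onto = (λ { zero → x ; (suc q) → f q }) , λ
  { (here refl) → zero , refl
  ; (there x∈)  → let q , eq = onto x∈ in suc q , eq
  }

-- With `c = k * k ∸ k` one has `k * k = c + k`, and `k ≤ c` because `2k ≤ k²`. Hence the `2c`
-- labels of a pair have room for all `k²` differences between two base blocks.
k²≤2[k²∸k] : ∀ {k} → 2 ≤ k → k * k ≤ (k * k ∸ k) + (k * k ∸ k)
k²≤2[k²∸k] {k} 2≤k = subst (_≤ c + c) (m∸n+n≡m k≤k²) (+-monoʳ-≤ c k≤c)
  where
  c = k * k ∸ k
  2k≤k² : k + k ≤ k * k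
  2k≤k² = ≤-trans (≤-reflexive (cong (λ z → k + z) (sym (+-identityʳ k)))) (*-monoˡ-≤ k 2≤k)
  k≤k² : k ≤ k * k
  k≤k² = ≤-trans (m≤m+n k k) 2k≤k²
  k≤c : k ≤ c
  k≤c = m+n≤o⇒m≤o∸n k 2k≤k²

module _ {p n} .{{_ : NonZero p}} (F : Fin n → Subset p) where

  shift-differences : Fin n → Fin n → List ℤ
  shift-differences i j = map (λ (x , y) → + toℕ y ℤ.- + toℕ x) (cartesianProduct (elements (F i)) (elements (F j)))

  length-shift-differences : ∀ {k} → (∀ i → ∣ F i ∣ ≡ k) → ∀ i j → length (shift-differences i j) ≡ k * k
  length-shift-differences ∣F∣≡k i j = trans (length-map _ (cartesianProduct (elements (F i)) (elements (F j))))
    (trans (length-cartesianProduct (elements (F i)) (elements (F j)))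
      (cong₂ _*_ (trans (length-elements (F i)) (∣F∣≡k i)) (trans (length-elements (F j)) (∣F∣≡k j))))

  avoiding⇒disjoint : ∀ (t : Fin n → ℕ) {i j} →
    (∀ {d} → d ∈ˡ shift-differences i j → ¬ + p ℤ.∣ + t j ℤ.- + t i ℤ.+ d) →
    Empty (translate (t i mod p) (F i) ∩ translate (t j mod p) (F j))
  avoiding⇒disjoint t {i} {j} avoids (z , z∈)
    with x∈p∩q⁻ (translate (t i mod p) (F i)) (translate (t j mod p) (F j)) z∈
  ... | z∈Fᵢ , z∈Fⱼ with overlap⇒∣ {F = F i} {F j} (t i) (t j) z∈Fᵢ z∈Fⱼ
  ...   | x , y , x∈ , y∈ , p∣ =
    avoids (∈-map⁺ _ (∈-cartesianProduct⁺ (∈-elements⁺ x∈) (∈-elements⁺ y∈))) p∣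

  -- The offsets of a pair include every `y - x` with `x` in `F i` and `y` in `F j`; the shifts
  -- avoiding them are natural numbers, reduced mod `p` at the end.
  disjoint-translates : ∀ {k} → 2 ≤ k → Prime p → (∀ i → ∣ F i ∣ ≡ k) → (k * k ∸ k) * n < p →
    ∃ λ (t : Fin n → Fin p) → AllPairs (λ G H → Empty (G ∩ H)) (List.tabulate λ i → translate (t i) (F i))
  disjoint-translates {k} 2≤k pp ∣F∣≡k cn<p = translations (avoidance pp n c cn<p (λ i j → proj₁ (offsets i j)))
    where
    c = k * k ∸ k
    offsets : ∀ i j → ∃ λ (f : Fin (c + c) → ℤ) → ∀ {d} → d ∈ˡ shift-differences i j → ∃ λ q → f q ≡ d
    offsets i j = enumerate 0ℤ (shift-differences i j)
      (≤-trans (≤-reflexive (length-shift-differences ∣F∣≡k i j)) (k²≤2[k²∸k] 2≤k))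
    translations : (∃ λ (t : Vec ℕ n) → ∀ {i j} → i Fin.< j → ∀ q →
                     ¬ + p ℤ.∣ + lookup t j ℤ.- + lookup t i ℤ.+ proj₁ (offsets i j) q) →
      ∃ λ (t : Fin n → Fin p) → AllPairs (λ G H → Empty (G ∩ H)) (List.tabulate λ i → translate (t i) (F i))
    translations (t , avoids) = (λ i → lookup t i mod p) , AllPairs.tabulate⁺-< λ {i} {j} i<j →
      avoiding⇒disjoint (lookup t) λ d∈ p∣ → let q , q≡d = proj₂ (offsets i j) d∈ in
        avoids i<j q (subst (λ d → + p ℤ.∣ + lookup t j ℤ.- + lookup t i ℤ.+ d) (sym q≡d) p∣)

theorem1 : ∀ (k p : ℕ) .{{_ : NonZero p}} → 2 ≤ k → Prime p → k ≢ p →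
    ∀ (𝓑 : List (Subset p)) → IsCyclicDesign p k 1 𝓑 →
    ∃ λ (𝓕 : List (Subset p)) → IsDDF p k 1 𝓕 × 𝓕 Generates 𝓑
theorem1 k p 2≤k pp k≢p 𝓑 cyc = disjointify (generators 𝓑
    -- The block size `k` is neither 0 nor `p`, so every orbit is full.
    (All.map (λ {B} → λ { refl → orbit-unique pp B (m<n⇒n≢0 2≤k) k≢p })
      (IsDesign.blockSize design))
    (IsCyclicDesign.translationInvariant cyc))
  where
  design : IsDesign p k 1 𝓑
  design = IsCyclicDesign.isDesign cyc
  disjointify : (∃ λ 𝓕 → 𝓕 Generates 𝓑) → ∃ λ (𝓕 : List (Subset p)) → IsDDF p k 1 𝓕 × 𝓕 Generates 𝓑
  disjointify (𝓕 , gen) = 𝓕′ , record { isCDF = generates⇒CDF gen′ design ; disjoint = proj₂ translations } , gen′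
    where
    cdf : IsCDF p k 1 𝓕
    cdf = generates⇒CDF gen design
    translations = disjoint-translates (List.lookup 𝓕) 2≤k pp
      (λ i → All.lookup (IsCDF.blockSize cdf) (∈-lookup i)) (CDF-size cdf)
    t = proj₁ translations
    𝓕′ = List.tabulate λ i → translate (t i) (List.lookup 𝓕 i)
    gen′ : 𝓕′ Generates 𝓑
    -- Replacing each base block by a translate keeps its orbit, so the development is unchanged up
    -- to order.
    gen′ = ↭-trans (development-cong λ i → orbit-translate (t i) (List.lookup 𝓕 i))
      (↭-trans (↭-reflexive (cong development (tabulate-lookup 𝓕))) gen)
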